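{- Let $n$ be a positive integer (sufficiently large) and let $m$ be an integer with $m>n^{2.5}$ and $m\le n^{C}$ for a fixed constant $C$. Then $M_{\mathsf{SH}}(m,n)\le \widetilde{\mathcal{O}}(n^{1/3})$, i.e. $M_{\mathsf{SH}}(m,n)\le n^{1/3}\cdot(\log n)^{\mathcal{O}(1)}$.
   Context: $[N]=\{0,\dots,N-1\}$; for positive integer $N$ and real $x$, $\mathfrak{m}_N(x)$ is the unique element of $(x+N\mathbb{Z})\cap[0,N)$; $\mathbb{Z}_N^{\times}$ is the set of $k\in[N]$ coprime to $N$. Smart linear hashing $\mathsf{SH}_m$ into $n$ bins: choose $a$ uniformly from $\mathbb{Z}_m^{\times}$ and place $x\in[m]$ in bin $\lfloor \mathfrak{m}_m(ax)/(m/n)\rfloor\in[n]$. The maxload on a set $X$ is the number of elements of $X$ in the fullest bin. $M_{\mathsf{SH}}(m,n)$ is the maximum, over all $n$-element $X\subset[m]$, of the expected maxload of $\mathsf{SH}_m$ on $X$. -}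

module Defs where

open import Data.Nat using (ℕ; zero; suc; _+_; _*_; _⊔_; NonZero)
open import Data.Nat.DivMod using (_/_; _%_)
open import Data.Nat.Coprimality using (Coprime; coprime?)
open import Data.Fin using (Fin; toℕ)
open import Data.Fin.Subset using (Subset; _∈_)
open import Data.Fin.Subset.Properties using (_∈?_)
open import Data.List using (List; length; filter; map; foldr; upTo; allFin)
open import Data.Nat.ListAction using (sum)
open import Data.Integer using (+_)
open import Data.Rational as ℚ using (ℚ)
open import Relation.Binary.PropositionalEquality using (_≡_)
open import Relation.Nullary.Decidable using (_×-dec_)
import Data.Nat.Properties as ℕP

units : ℕ → List ℕ
units m = filter (λ k → coprime? k m) (upTo m)

-- bin of x under multiplier a:  ⌊ 𝔪_m(a x) / (m/n) ⌋ = ⌊ n · ((a x) mod m) / m ⌋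
bin : (m n a x : ℕ) → .{{NonZero m}} → ℕ
bin m n a x = (n * ((a * x) % m)) / m

load : (m n a : ℕ) → .{{NonZero m}} → Subset m → ℕ → ℕ
load m n a X b =
  length (filter (λ (x : Fin m) → (x ∈? X) ×-dec (bin m n a (toℕ x) ℕP.≟ b)) (allFin m))

maxload : (m n a : ℕ) → .{{NonZero m}} → Subset m → ℕ
maxload m n a X = foldr _⊔_ 0 (map (load m n a X) (upTo n))

-- rational division s / u (u = 0 never occurs for the uses below, since 1 ∈ Z_m^×)
divℚ : ℕ → ℕ → ℚ
divℚ s zero    = ℚ.0ℚ
divℚ s (suc u) = (+ s) ℚ./ suc u

expectedMaxload : (m n : ℕ) → .{{NonZero m}} → Subset m → ℚ
expectedMaxload m n X =
  divℚ (sum (map (λ a → maxload m n a X) (units m))) (length (units m))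

ℕtoℚ : ℕ → ℚ
ℕtoℚ k = (+ k) ℚ./ 1

{-# OPTIONS --safe #-}

-- Call a unit a of ℤ/m rich if some bin receives at least L elements of X.  It suffices to show that the proportion of rich
-- units is at most n polylog(n) / L³; the bound on the third moment, and hence on the mean, follows by summing over dyadic L.
--
-- Fix a unit b and let p run over the primes below L/16.  If p b is rich, its L points, viewed under b, fall into p classes
-- according to ⌊p y / m⌋, and two points of one class are within m / (n p) of each other.  For distinct primes p and q, the
-- points common to both rich bins lie in a single class modulo p, so the pairs contributed by different primes barely
-- overlap: t rich multiples p b yield about t L distinct pairs at distance at most m / (n L) under b.  On the other hand a
-- pair x ≠ x′ is that close for few units: if this happens under q⁻¹ b for several primes q, then all those q divide one
-- positive integer below m, so there are at most log₂ m of them among the roughly n L primes q up to n L / 2.  Double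
-- counting the triples (b, x, x′) gives the claim.  Logarithmic factors are disregarded throughout, so a weak form of
-- Chebyshev's lower bound on the number of primes suffices; it comes from the least common multiple of 1, …, Q.

module Submission where

open import Defs
open import Data.Nat using (ℕ; _+_; _*_; _^_; _<_; _≤_; NonZero)
open import Data.Nat.Logarithm using (⌊log₂_⌋)
open import Data.Fin.Subset using (Subset; ∣_∣)
open import Data.Rational as ℚ using (ℚ)
open import Data.Product using (Σ; _×_; ∃-syntax)
open import Relation.Binary.PropositionalEquality using (_≡_)

open import Data.Bool using (true; false; if_then_else_)
open import Data.Fin using (toℕ; zero; suc)
open import Data.Fin.Properties using (toℕ<n; toℕ-injective)
open import Data.Fin.Subset.Properties using (_∈?_)
open import Data.Integer as ℤ using (ℤ; +_; 0ℤ)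
import Data.Integer.Properties as ℤ
import Data.Integer.Tactic.RingSolver as ℤSolver
open import Data.List using (List; []; _∷_; _++_; length; filter; map; foldr; upTo; allFin; tabulate; cartesianProduct)
open import Data.List.Properties using (map-cong; map-tabulate; length-map; length-filter; length-upTo)
open import Data.List.Membership.Propositional using (_∈_)
open import Data.List.Membership.Propositional.Properties
  using (∈-∃++; ∈-++⁻; ∈-++⁺ˡ; ∈-++⁺ʳ; ∈-filter⁻; ∈-filter⁺; ∈-upTo⁻; ∈-upTo⁺; ∈-map⁻)
open import Data.List.Relation.Unary.All as All using (All; []; _∷_)
open import Data.List.Relation.Unary.AllPairs using (AllPairs; []; _∷_)
open import Data.List.Relation.Unary.Any using (here; there)
open import Data.List.Relation.Unary.Unique.Propositional using (Unique)
open import Data.List.Relation.Unary.Unique.Propositional.Properties using (filter⁺; upTo⁺; allFin⁺; map⁺)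
open import Data.Nat
open import Data.Nat.Coprimality using (Coprime; coprime?; coprime-Bézout; coprime-factors; coprime-divisor)
  renaming (sym to coprime-sym)
open import Data.Nat.Divisibility
open import Data.Nat.DivMod
open import Data.Nat.GCD using (module Bézout)
open import Data.Nat.ListAction using (sum; product)
open import Data.Nat.ListAction.Properties using (∈⇒∣product)
open import Data.Nat.Logarithm using (⌊log₂⌋-mono-≤; ⌊log₂[2^n]⌋≡n)
open import Data.Nat.Primality
open import Data.Nat.Primality.Factorisation using (factorise; module PrimeFactorisation)
open import Data.Nat.Properties
open import Data.Nat.Solver using (module +-*-Solver)
open import Data.Nat.Tactic.RingSolver using (solve-∀)
open import Data.Product using (_,_; proj₁; proj₂)
import Data.Rational.Properties as ℚ
open import Data.Rational.Unnormalised as ℚᵘ using (mkℚᵘ; *≤*)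
import Data.Rational.Unnormalised.Properties as ℚᵘ
open import Data.Sum using (inj₁; inj₂; [_,_]′)
import Data.Vec as Vec
open import Function using (_∘_; id)
open import Relation.Binary.PropositionalEquality
open import Relation.Nullary using (Dec; yes; no; does; ¬_; contradiction)
open import Relation.Nullary.Decidable using (_×-dec_; ¬?)
open import Relation.Unary using (Pred; Decidable)

-- Sums over lists

private variable
  I E : Set
  Φ Ψ : Set

∑ : List I → (I → ℕ) → ℕ
∑ xs f = sum (map f xs)

𝟙 : Dec Φ → ℕ
𝟙 d = if does d then 1 else 0

𝟙≤1 : (d : Dec Φ) → 𝟙 d ≤ 1
𝟙≤1 (yes _) = ≤-refl
𝟙≤1 (no _) = z≤n

𝟙-yes : (d : Dec Φ) → Φ → 𝟙 d ≡ 1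
𝟙-yes (yes _) p = refl
𝟙-yes (no ¬p) p = contradiction p ¬p

𝟙-no : (d : Dec Φ) → ¬ Φ → 𝟙 d ≡ 0
𝟙-no (yes p) ¬p = contradiction p ¬p
𝟙-no (no _) ¬p = refl

𝟙-bound : (d : Dec Φ) {k : ℕ} → (Φ → 1 ≤ k) → 𝟙 d ≤ k
𝟙-bound (yes p) h = h p
𝟙-bound (no _) h = z≤n

𝟙-mono : (d : Dec Φ) (e : Dec Ψ) → (Φ → Ψ) → 𝟙 d ≤ 𝟙 e
𝟙-mono d e h = 𝟙-bound d (λ p → ≤-reflexive (sym (𝟙-yes e (h p))))

𝟙>0 : (d : Dec Φ) → 1 ≤ 𝟙 d → Φ
𝟙>0 (yes p) _ = p

∑-cong : {f g : I → ℕ} → (∀ x → f x ≡ g x) → (xs : List I) → ∑ xs f ≡ ∑ xs g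
∑-cong eq xs = cong sum (map-cong eq xs)

∑-mono : {f g : I → ℕ} (xs : List I) → (∀ {x} → x ∈ xs → f x ≤ g x) → ∑ xs f ≤ ∑ xs g
∑-mono [] h = z≤n
∑-mono (x ∷ xs) h = +-mono-≤ (h (here refl)) (∑-mono xs (h ∘ there))

∑-+ : (f g : I → ℕ) (xs : List I) → ∑ xs (λ x → f x + g x) ≡ ∑ xs f + ∑ xs g
∑-+ f g [] = refl
∑-+ f g (x ∷ xs) rewrite ∑-+ f g xs =
  solve 4 (λ a b c d → (a :+ b) :+ (c :+ d) := (a :+ c) :+ (b :+ d)) refl (f x) (g x) (∑ xs f) (∑ xs g)
  where open +-*-Solver

∑-*ˡ : (c : ℕ) (f : I → ℕ) (xs : List I) → ∑ xs (λ x → c * f x) ≡ c * ∑ xs f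
∑-*ˡ c f [] = sym (*-zeroʳ c)
∑-*ˡ c f (x ∷ xs) rewrite ∑-*ˡ c f xs = sym (*-distribˡ-+ c (f x) _)

∑-*ʳ : (c : ℕ) (f : I → ℕ) (xs : List I) → ∑ xs (λ x → f x * c) ≡ ∑ xs f * c
∑-*ʳ c f xs = trans (∑-cong (λ x → *-comm (f x) c) xs) (trans (∑-*ˡ c f xs) (*-comm c _))

∑-const : (c : ℕ) (xs : List I) → ∑ xs (λ _ → c) ≡ length xs * c
∑-const c [] = refl
∑-const c (x ∷ xs) = cong (λ t → c + t) (∑-const c xs)

∑-zero : (xs : List I) → ∑ xs (λ _ → 0) ≡ 0
∑-zero xs = trans (∑-const 0 xs) (*-zeroʳ (length xs))

∑-swap : (xs : List I) (ys : List E) (f : I → E → ℕ) →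
  ∑ xs (λ x → ∑ ys (f x)) ≡ ∑ ys (λ y → ∑ xs (λ x → f x y))
∑-swap [] ys f = sym (∑-zero ys)
∑-swap (x ∷ xs) ys f rewrite ∑-swap xs ys f = sym (∑-+ (f x) (λ y → ∑ xs (λ x → f x y)) ys)

∑-≤-const : {f : I → ℕ} {c : ℕ} (xs : List I) → (∀ {x} → x ∈ xs → f x ≤ c) → ∑ xs f ≤ length xs * c
∑-≤-const {c = c} xs h = ≤-trans (∑-mono xs h) (≤-reflexive (∑-const c xs))

∑-++ : (f : I → ℕ) (xs ys : List I) → ∑ (xs ++ ys) f ≡ ∑ xs f + ∑ ys f
∑-++ f [] ys = refl
∑-++ f (x ∷ xs) ys = trans (cong (λ t → f x + t) (∑-++ f xs ys)) (sym (+-assoc (f x) _ _))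

∈⇒≤∑ : (f : I → ℕ) {x : I} {xs : List I} → x ∈ xs → f x ≤ ∑ xs f
∈⇒≤∑ f (here refl) = m≤m+n _ _
∈⇒≤∑ f (there x∈xs) = ≤-trans (∈⇒≤∑ f x∈xs) (m≤n+m _ _)

∑-map : (f : E → ℕ) (g : I → E) (xs : List I) → ∑ (map g xs) f ≡ ∑ xs (f ∘ g)
∑-map f g [] = refl
∑-map f g (x ∷ xs) = cong (λ t → f (g x) + t) (∑-map f g xs)

∑-filter : {R : Pred I _} (R? : Decidable R) (f : I → ℕ) (xs : List I) →
  ∑ (filter R? xs) f ≡ ∑ xs (λ x → 𝟙 (R? x) * f x)
∑-filter R? f [] = refl
∑-filter R? f (x ∷ xs) with R? x
... | yes _ = cong₂ _+_ (sym (+-identityʳ (f x))) (∑-filter R? f xs)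
... | no _ = ∑-filter R? f xs

length-filter-∑ : {R : Pred I _} (R? : Decidable R) (xs : List I) →
  length (filter R? xs) ≡ ∑ xs (λ x → 𝟙 (R? x))
length-filter-∑ R? [] = refl
length-filter-∑ R? (x ∷ xs) with R? x
... | yes _ = cong suc (length-filter-∑ R? xs)
... | no _ = length-filter-∑ R? xs

∑-image : {xs : List I} {ys : List E} (g : I → E) (f : E → ℕ) → Unique xs →
  (∀ {x} → x ∈ xs → g x ∈ ys) → (∀ {x y} → x ∈ xs → y ∈ xs → g x ≡ g y → x ≡ y) →
  ∑ xs (f ∘ g) ≤ ∑ ys f
∑-image {xs = []} g f _ _ _ = z≤n
∑-image {xs = x ∷ xs} {ys} g f (x∉xs ∷ uxs) into inj with ∈-∃++ (into (here refl))
... | as , bs , refl = begin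
  f (g x) + ∑ xs (f ∘ g)        ≤⟨ +-monoʳ-≤ (f (g x)) (∑-image g f uxs into′ (λ p q → inj (there p) (there q))) ⟩
  f (g x) + ∑ (as ++ bs) f      ≡⟨ cong (λ t → f (g x) + t) (∑-++ f as bs) ⟩
  f (g x) + (∑ as f + ∑ bs f)   ≡⟨ solve 3 (λ a b c → a :+ (b :+ c) := b :+ (a :+ c)) refl (f (g x)) (∑ as f) (∑ bs f) ⟩
  ∑ as f + (f (g x) + ∑ bs f)   ≡⟨ ∑-++ f as (g x ∷ bs) ⟨
  ∑ (as ++ g x ∷ bs) f          ∎
  where
  open ≤-Reasoning
  open +-*-Solver
  into′ : ∀ {y} → y ∈ xs → g y ∈ as ++ bs
  into′ y∈xs with ∈-++⁻ as (into (there y∈xs))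
  ... | inj₁ l = ∈-++⁺ˡ l
  ... | inj₂ (here eq) = contradiction (sym (inj (there y∈xs) (here refl) eq)) (All.lookup x∉xs y∈xs)
  ... | inj₂ (there r) = ∈-++⁺ʳ as r

length-image : {xs : List I} {ys : List E} (g : I → E) → Unique xs →
  (∀ {x} → x ∈ xs → g x ∈ ys) → (∀ {x y} → x ∈ xs → y ∈ xs → g x ≡ g y → x ≡ y) →
  length xs ≤ length ys
length-image {xs = xs} {ys} g u into inj =
  subst₂ _≤_ (trans (∑-const 1 xs) (*-identityʳ _)) (trans (∑-const 1 ys) (*-identityʳ _))
    (∑-image g (λ _ → 1) u into inj)

-- An averaging bound free of division, for use when the bound on a single term improves with the
-- length of the list.
∑-average : {f : I → ℕ} {K : ℕ} (xs : List I) → (∀ {x} → x ∈ xs → length xs * f x ≤ K) → ∑ xs f ≤ K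
∑-average [] h = z≤n
∑-average {f = f} {K} xs@(_ ∷ _) h = *-cancelˡ-≤ (length xs)
  (≤-trans (≤-reflexive (sym (∑-*ˡ (length xs) f xs))) (∑-≤-const xs h))

-- Prime divisors and the number of primes

2≤prime : ∀ {p} → Prime p → 2 ≤ p
2≤prime {p} pp = nonTrivial⇒n>1 p {{prime⇒nonTrivial pp}}

prime∣prime : ∀ {p q} → Prime p → Prime q → p ∣ q → p ≡ q
prime∣prime pp pq p∣q with prime⇒irreducible pq p∣q
... | inj₁ refl = contradiction pp ¬prime[1]
... | inj₂ p≡q = p≡q

-- Once `p` is divided out of `v`, the other primes still divide the quotient by Euclid's lemma, and
-- each division at least halves the number.
2^length≤ : ∀ {v} {ps : List ℕ} .{{_ : NonZero v}} → Unique ps → All Prime ps → All (_∣ v) ps → 2 ^ length ps ≤ v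
2^length≤ {v} {[]} _ _ _ = >-nonZero⁻¹ v
2^length≤ {v} {p ∷ ps} {{v≢0}} (p∉ps ∷ ups) (pp ∷ pps) (divides q v≡qp ∷ ps∣v) = begin
  2 * 2 ^ length ps  ≤⟨ *-mono-≤ (2≤prime pp) (2^length≤ {{m*n≢0⇒m≢0 q {{subst NonZero v≡qp v≢0}}}} ups pps ps∣q) ⟩
  p * q              ≡⟨ *-comm p q ⟩
  q * p              ≡⟨ v≡qp ⟨
  v                  ∎
  where
  open ≤-Reasoning
  ps∣q : All (_∣ q) ps
  ps∣q = All.tabulate λ {r} r∈ps →
    [ id , (λ r∣p → contradiction (sym (prime∣prime (All.lookup pps r∈ps) pp r∣p)) (All.lookup p∉ps r∈ps)) ]′
    (euclidsLemma q p (All.lookup pps r∈ps) (subst (r ∣_) v≡qp (All.lookup ps∣v r∈ps)))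

-- Binomial coefficients and common multiples of 1, ..., r + 1

binom : ℕ → ℕ → ℕ
binom _ zero = 1
binom zero (suc _) = 0
binom (suc n) (suc k) = binom n k + binom n (suc k)

binom-zero : ∀ {n k} → n < k → binom n k ≡ 0
binom-zero {zero} {suc k} _ = refl
binom-zero {suc n} {suc k} (s≤s n<k) = cong₂ _+_ (binom-zero n<k) (binom-zero (m<n⇒m<1+n n<k))

binom>0 : ∀ {n k} → k ≤ n → 0 < binom n k
binom>0 {k = zero} _ = s≤s z≤n
binom>0 {suc n} {suc k} (s≤s k≤n) = ≤-trans (binom>0 k≤n) (m≤m+n _ _)

binom-absorb : ∀ n k → suc k * binom (suc n) (suc k) ≡ suc n * binom n k
binom-absorb zero zero = refl
binom-absorb zero (suc k) = *-zeroʳ (suc (suc k))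
binom-absorb (suc n) zero = begin
  binom (suc (suc n)) 1 + 0                  ≡⟨ +-identityʳ _ ⟩
  1 + binom (suc n) 1                        ≡⟨ cong suc (sym (*-identityˡ _)) ⟩
  1 + 1 * binom (suc n) 1                    ≡⟨ cong suc (binom-absorb n zero) ⟩
  1 + suc n * 1                              ∎
  where open ≡-Reasoning
binom-absorb (suc n) (suc k) = begin
  suc (suc k) * (a + b)                      ≡⟨ solve 3 (λ k a b → (con 2 :+ k) :* (a :+ b) := (con 1 :+ k) :* a :+ a :+ (con 2 :+ k) :* b) refl k a b ⟩
  suc k * a + a + suc (suc k) * b            ≡⟨ cong₂ (λ u v → u + a + v) (binom-absorb n k) (binom-absorb n (suc k)) ⟩
  suc n * c + a + suc n * d                  ≡⟨ solve 3 (λ n c d → (con 1 :+ n) :* c :+ (c :+ d) :+ (con 1 :+ n) :* d := (con 2 :+ n) :* (c :+ d)) refl n c d ⟩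
  suc (suc n) * (c + d)                      ∎
  where
  open ≡-Reasoning
  open +-*-Solver
  a = binom (suc n) (suc k)
  b = binom (suc n) (suc (suc k))
  c = binom n k
  d = binom n (suc k)

-- This is (n + 1) C(n, k) = (n + 1 - k) C(n + 1, k), with the negative term moved to the left to
-- avoid truncated subtraction.
binom-absorb′ : ∀ n k → suc n * binom n k + k * binom (suc n) k ≡ suc n * binom (suc n) k
binom-absorb′ n zero = +-identityʳ _
binom-absorb′ n (suc k) = begin
  suc n * b + suc k * (a + b)  ≡⟨ cong (λ t → suc n * b + t) (binom-absorb n k) ⟩
  suc n * b + suc n * a        ≡⟨ solve 3 (λ n a b → (con 1 :+ n) :* b :+ (con 1 :+ n) :* a := (con 1 :+ n) :* (a :+ b)) refl n a b ⟩
  suc n * (a + b)              ∎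
  where
  open ≡-Reasoning
  open +-*-Solver
  a = binom n k
  b = binom n (suc k)

-- Leibniz's harmonic triangle: 1 / b(r,c) − 1 / b(r+1,c) = 1 / b(r+1,c+1) for b(r,c) = (r+1) C(r,c).
leibniz-step : ∀ r c {D} → c ≤ r → suc r * binom r c ∣ D → suc (suc r) * binom (suc r) c ∣ D →
  suc (suc r) * binom (suc r) (suc c) ∣ D
leibniz-step r c {D} c≤r (divides s D≡s) (divides t D≡t) = divides q (sym q*b≡D)
  where
  y = binom r c
  x = binom (suc r) c
  z = binom (suc r) (suc c)
  ry≤rx : suc r * y ≤ suc r * x
  ry≤rx = ≤-trans (m≤m+n _ (c * x)) (≤-reflexive (binom-absorb′ r c))
  instance
    x≢0 : NonZero x
    x≢0 = >-nonZero (binom>0 (m≤n⇒m≤1+n c≤r))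
  -- The larger entry fits into `D` fewer times, so the truncated subtraction that defines `q` is
  -- exact.
  t≤s : t ≤ s
  t≤s = *-cancelʳ-≤ t s (suc r * x) {{m*n≢0 (suc r) x}} (begin
    t * (suc r * x)          ≤⟨ *-monoʳ-≤ t (*-monoˡ-≤ x (n≤1+n (suc r))) ⟩
    t * (suc (suc r) * x)    ≡⟨ D≡t ⟨
    D                        ≡⟨ D≡s ⟩
    s * (suc r * y)          ≤⟨ *-monoʳ-≤ s ry≤rx ⟩
    s * (suc r * x)          ∎)
    where open ≤-Reasoning
  q = s ∸ t
  D≡ : D ≡ (q + t) * (suc r * y)
  D≡ = trans D≡s (cong (_* (suc r * y)) (sym (m∸n+n≡m t≤s)))
  open +-*-Solver
  open ≡-Reasoning
  -- The summand `suc r * D` on both sides replaces a subtraction; it is cancelled in `q*b≡D`.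
  key : q * (suc (suc r) * (suc r * y)) + suc r * D ≡ suc c * D + suc r * D
  key = begin
    q * (suc (suc r) * (suc r * y)) + suc r * D
      ≡⟨ cong (λ u → q * (suc (suc r) * (suc r * y)) + suc r * u) D≡t ⟩
    q * (suc (suc r) * (suc r * y)) + suc r * (t * (suc (suc r) * x))
      ≡⟨ cong (λ t → q * (suc (suc r) * (suc r * y)) + t)
           (solve 3 (λ r t x → (con 1 :+ r) :* (t :* ((con 2 :+ r) :* x)) := t :* (con 2 :+ r) :* ((con 1 :+ r) :* x)) refl r t x) ⟩
    q * (suc (suc r) * (suc r * y)) + t * suc (suc r) * (suc r * x)
      ≡⟨ cong (λ u → q * (suc (suc r) * (suc r * y)) + t * suc (suc r) * u) (sym (binom-absorb′ r c)) ⟩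
    q * (suc (suc r) * (suc r * y)) + t * suc (suc r) * (suc r * y + c * x)
      ≡⟨ solve 6 (λ q r t y c x → q :* ((con 2 :+ r) :* ((con 1 :+ r) :* y)) :+ t :* (con 2 :+ r) :* ((con 1 :+ r) :* y :+ c :* x)
                  := (con 2 :+ r) :* ((q :+ t) :* ((con 1 :+ r) :* y)) :+ c :* (t :* ((con 2 :+ r) :* x))) refl q r t y c x ⟩
    suc (suc r) * ((q + t) * (suc r * y)) + c * (t * (suc (suc r) * x))
      ≡⟨ cong₂ (λ u v → suc (suc r) * u + c * v) (sym D≡) (sym D≡t) ⟩
    suc (suc r) * D + c * D
      ≡⟨ solve 3 (λ r c D → (con 2 :+ r) :* D :+ c :* D := (con 1 :+ c) :* D :+ (con 1 :+ r) :* D) refl r c D ⟩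
    suc c * D + suc r * D ∎
  q*b≡D : q * (suc (suc r) * z) ≡ D
  q*b≡D = *-cancelˡ-≡ _ _ (suc c) (begin
    suc c * (q * (suc (suc r) * z))   ≡⟨ solve 4 (λ c q r z → (con 1 :+ c) :* (q :* ((con 2 :+ r) :* z)) := q :* ((con 2 :+ r) :* ((con 1 :+ c) :* z))) refl c q r z ⟩
    q * (suc (suc r) * (suc c * z))   ≡⟨ cong (λ u → q * (suc (suc r) * u)) (binom-absorb r c) ⟩
    q * (suc (suc r) * (suc r * y))   ≡⟨ +-cancelʳ-≡ (suc r * D) _ _ key ⟩
    suc c * D ∎)

-- The left edge of the triangle consists of the numbers r + 1 themselves; `leibniz-step` then moves
-- one column to the right at a time.
leibniz-∣ : ∀ r c {D} → c ≤ r → (∀ {k} → 0 < k → k ≤ suc r → k ∣ D) → suc r * binom r c ∣ D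
leibniz-∣ r zero {D} _ h = subst (_∣ D) (sym (*-identityʳ (suc r))) (h (s≤s z≤n) ≤-refl)
leibniz-∣ (suc r) (suc c) (s≤s c≤r) h =
  leibniz-step r c c≤r (leibniz-∣ r c c≤r (λ 0<k k≤ → h 0<k (m≤n⇒m≤1+n k≤))) (leibniz-∣ (suc r) c (m≤n⇒m≤1+n c≤r) h)

rowSum : ℕ → ℕ → ℕ
rowSum n zero = 1
rowSum n (suc k) = rowSum n k + binom n (suc k)

rowSum-suc : ∀ n k → rowSum (suc n) (suc k) ≡ rowSum n k + rowSum n (suc k)
rowSum-suc n zero = refl
rowSum-suc n (suc k) rewrite rowSum-suc n k =
  solve 4 (λ a b c d → (a :+ b) :+ (c :+ d) := (a :+ c) :+ (b :+ d)) refl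
    (rowSum n k) (rowSum n (suc k)) (binom n (suc k)) (binom n (suc (suc k)))
  where open +-*-Solver

rowSum≡2^ : ∀ n → rowSum n n ≡ 2 ^ n
rowSum≡2^ zero = refl
rowSum≡2^ (suc n) = begin
  rowSum (suc n) (suc n)               ≡⟨ rowSum-suc n n ⟩
  rowSum n n + (rowSum n n + binom n (suc n)) ≡⟨ cong (λ u → rowSum n n + (rowSum n n + u)) (binom-zero {n} {suc n} ≤-refl) ⟩
  rowSum n n + (rowSum n n + 0)        ≡⟨ cong (λ u → u + (u + 0)) (rowSum≡2^ n) ⟩
  2 ^ suc n                            ∎
  where open ≡-Reasoning

-- Each of the r + 1 numbers (r + 1) C(r, k) divides `D` and is therefore at most `D`. Their sum is
-- (r + 1) 2^r.
2^≤common-multiple : ∀ r D .{{_ : NonZero D}} → (∀ {k} → 0 < k → k ≤ suc r → k ∣ D) → 2 ^ r ≤ D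
2^≤common-multiple r D h = *-cancelˡ-≤ (suc r) (subst (λ u → suc r * u ≤ suc r * D) (rowSum≡2^ r) (bound r ≤-refl))
  where
  open ≤-Reasoning
  bound : ∀ k → k ≤ r → suc r * rowSum r k ≤ suc k * D
  bound zero k≤r = ≤-trans (∣⇒≤ (leibniz-∣ r 0 z≤n h)) (≤-reflexive (sym (+-identityʳ D)))
  bound (suc k) k<r = begin
    suc r * (rowSum r k + binom r (suc k))           ≡⟨ *-distribˡ-+ (suc r) (rowSum r k) _ ⟩
    suc r * rowSum r k + suc r * binom r (suc k)     ≤⟨ +-mono-≤ (bound k (<⇒≤ k<r)) (∣⇒≤ (leibniz-∣ r (suc k) k<r h)) ⟩
    suc k * D + D                                    ≡⟨ +-comm _ D ⟩
    suc (suc k) * D                                  ∎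

-- A lower bound for the number of primes

primesUpTo : ℕ → List ℕ
primesUpTo Q = filter prime? (upTo (suc Q))

primesUpTo-unique : ∀ Q → Unique (primesUpTo Q)
primesUpTo-unique Q = filter⁺ prime? (upTo⁺ (suc Q))

∈-primesUpTo⁺ : ∀ {p Q} → Prime p → p ≤ Q → p ∈ primesUpTo Q
∈-primesUpTo⁺ pp p≤Q = ∈-filter⁺ prime? (∈-upTo⁺ (s≤s p≤Q)) pp

∈-primesUpTo⁻ : ∀ {p Q} → p ∈ primesUpTo Q → Prime p × p ≤ Q
∈-primesUpTo⁻ {Q = Q} p∈ with ∈-filter⁻ prime? {xs = upTo (suc Q)} p∈
... | p∈upTo , pp = pp , s≤s⁻¹ (∈-upTo⁻ p∈upTo)

product∣^length : ∀ {R} {fs : List ℕ} → All (_∣ R) fs → product fs ∣ R ^ length fs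
product∣^length [] = ∣-refl
product∣^length (f∣R ∷ fs∣R) = *-pres-∣ f∣R (product∣^length fs∣R)

2^length≤product : ∀ {fs} → All Prime fs → 2 ^ length fs ≤ product fs
2^length≤product [] = ≤-refl
2^length≤product (pf ∷ pfs) = *-mono-≤ (2≤prime pf) (2^length≤product pfs)

2^-cancel-< : ∀ {i j} → 2 ^ i < 2 ^ j → i < j
2^-cancel-< {i} {j} h = ≰⇒> λ j≤i → <⇒≱ h (^-monoʳ-≤ 2 j≤i)

2^-cancel-≤ : ∀ {i j} → 2 ^ i ≤ 2 ^ j → i ≤ j
2^-cancel-≤ {i} {j} h = ≮⇒≥ λ j<i → ≤⇒≯ h (^-monoʳ-< 2 ≤-refl j<i)

-- A number below `2 ^ h` has fewer than `h` prime factors, counted with multiplicity, and each of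
-- them divides the product of all primes up to `Q`.
primorial^-∣ : ∀ {Q h k} → Q < 2 ^ h → 0 < k → k ≤ Q → k ∣ product (primesUpTo Q) ^ h
primorial^-∣ {Q} {h} {k} Q<2^h 0<k k≤Q =
  subst (_∣ _) (sym isFactorisation)
    (∣-trans (product∣^length (All.tabulate divides-primorial)) (m≤n⇒m^l∣ (<⇒≤ length<h)))
  where
  instance
    k≢0 : NonZero k
    k≢0 = >-nonZero 0<k
  open PrimeFactorisation (factorise k) using (isFactorisation; factorsPrime) renaming (factors to fs)
  length<h : length fs < h
  length<h = 2^-cancel-< (≤-<-trans (2^length≤product factorsPrime)
    (≤-<-trans (≤-trans (≤-reflexive (sym isFactorisation)) k≤Q) Q<2^h))
  divides-primorial : ∀ {f} → f ∈ fs → f ∣ product (primesUpTo Q)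
  divides-primorial f∈fs = ∈⇒∣product (∈-primesUpTo⁺ (All.lookup factorsPrime f∈fs)
    (≤-trans (∣⇒≤ (subst (_ ∣_) (sym isFactorisation) (∈⇒∣product f∈fs))) k≤Q))
  m≤n⇒m^l∣ : ∀ {R i j} → i ≤ j → R ^ i ∣ R ^ j
  m≤n⇒m^l∣ {R} {i} {j} i≤j = divides (R ^ (j ∸ i))
    (trans (cong (R ^_) (sym (m∸n+n≡m i≤j))) (^-distribˡ-+-* R (j ∸ i) i))

product≤ : ∀ {ps b} → All (_≤ b) ps → product ps ≤ b ^ length ps
product≤ [] = ≤-refl
product≤ (p≤b ∷ ps≤b) = *-mono-≤ p≤b (product≤ ps≤b)

-- The power `product ps ^ h` is a common multiple of 1, ..., Q, so it is at least 2^(Q - 1); on the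
-- other hand it is a product of h π primes below `2 ^ h`. Comparing exponents loses only the factor
-- `h * h`.
primeCount-lower : ∀ {Q h} → Q < 2 ^ h → Q ≤ 1 + h * h * length (primesUpTo Q)
primeCount-lower {zero} _ = z≤n
primeCount-lower {Q@(suc r)} {h} Q<2^h = s≤s (2^-cancel-≤ (begin
  2 ^ r                   ≤⟨ 2^≤common-multiple r D (λ 0<k k≤Q → primorial^-∣ {h = h} Q<2^h 0<k k≤Q) ⟩
  product ps ^ h          ≤⟨ ^-monoˡ-≤ h (product≤ (All.tabulate λ p∈ps → ≤-trans (proj₂ (∈-primesUpTo⁻ p∈ps)) (<⇒≤ Q<2^h))) ⟩
  ((2 ^ h) ^ π) ^ h       ≡⟨ cong (_^ h) (^-*-assoc 2 h π) ⟩
  (2 ^ (h * π)) ^ h       ≡⟨ ^-*-assoc 2 (h * π) h ⟩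
  2 ^ (h * π * h)         ≡⟨ cong (2 ^_) (solve 2 (λ h π → h :* π :* h := h :* h :* π) refl h π) ⟩
  2 ^ (h * h * π)         ∎))
  where
  open ≤-Reasoning
  open +-*-Solver
  ps = primesUpTo Q
  π = length ps
  D = product ps ^ h
  instance
    D≢0 : NonZero D
    D≢0 = m^n≢0 (product ps) h {{productOfPrimes≢0 {ps} (All.tabulate λ p∈ps → proj₁ (∈-primesUpTo⁻ {Q = Q} p∈ps))}}

-- Inverses modulo m

ModInverse : ℕ → ℕ → ℕ → Set
ModInverse m q r = ∃[ k ] q * r ≡ 1 + k * m

modInverse : ∀ {m q} .{{_ : NonZero m}} .{{_ : NonZero q}} → Coprime q m → ∃[ r ] ModInverse m q r
modInverse {m@(suc m′)} {q@(suc q′)} c with coprime-Bézout c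
... | Bézout.+- x y eq = x , y , trans (*-comm q x) (sym eq)
-- Here the inverse is -x, represented by x (m - 1); the additional `m` makes the cofactor y (m - 1)
-- + (q - 1) visibly a natural number.
... | Bézout.-+ x y eq = x * m′ + m , y * m′ + q′ , +-cancelʳ-≡ m′ _ _ (begin
  q * (x * m′ + m) + m′            ≡⟨ solve 3 (λ q x m′ → q :* (x :* m′ :+ (con 1 :+ m′)) :+ m′ := (con 1 :+ x :* q) :* m′ :+ q :* (con 1 :+ m′)) refl q x m′ ⟩
  (1 + x * q) * m′ + q * m         ≡⟨ cong (λ u → u * m′ + q * m) eq ⟩
  (y * m) * m′ + q * m             ≡⟨ solve 3 (λ y m′ q′ → (y :* (con 1 :+ m′)) :* m′ :+ (con 1 :+ q′) :* (con 1 :+ m′) := con 1 :+ (y :* m′ :+ q′) :* (con 1 :+ m′) :+ m′) refl y m′ q′ ⟩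
  1 + (y * m′ + q′) * m + m′       ∎)
  where
  open ≡-Reasoning
  open +-*-Solver

prime∤⇒coprime : ∀ {p m} → Prime p → ¬ p ∣ m → Coprime p m
prime∤⇒coprime pp p∤m (d∣p , d∣m) with prime⇒irreducible pp d∣p
... | inj₁ refl = refl
... | inj₂ refl = contradiction d∣m p∤m

modInverse-coprime : ∀ {m q r} → ModInverse m q r → Coprime r m
modInverse-coprime {m} {q} {r} (k , eq) {d} (d∣r , d∣m) = ∣1⇒≡1 (∣m+n∣m⇒∣n {m = k * m} {n = 1} d∣ (∣n⇒∣m*n k d∣m))
  where
  d∣ : d ∣ k * m + 1
  d∣ = subst (d ∣_) (trans eq (+-comm 1 (k * m))) (∣n⇒∣m*n q d∣r)

-- Small residues

-- Defined through ℤ so that ring identities about signed differences transfer to it.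
dist : ℕ → ℕ → ℕ
dist a b = ℤ.∣ + a ℤ.- + b ∣

dist≤⊔ : ∀ a b → dist a b ≤ a ⊔ b
dist≤⊔ a b = subst (λ i → ℤ.∣ i ∣ ≤ a ⊔ b) (sym (ℤ.[+m]-[+n]≡m⊖n a b)) (ℤ.∣m⊝n∣≤m⊔n a b)

dist≡0⇒≡ : ∀ {a b} → dist a b ≡ 0 → a ≡ b
dist≡0⇒≡ {a} {b} eq = ℤ.+-injective (ℤ.i-j≡0⇒i≡j (+ a) (+ b) (ℤ.∣i∣≡0⇒i≡0 eq))

dist< : ∀ {a b c} → a < c → b < c → dist a b < c
dist< {a} {b} a<c b<c = ≤-<-trans (dist≤⊔ a b) (⊔-lub a<c b<c)

congruent-small : ∀ {m} {i j e : ℤ} → i ℤ.- j ≡ e ℤ.* + m → ℤ.∣ i ∣ + ℤ.∣ j ∣ < m → i ≡ j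
congruent-small {m} {i} {j} {e} eq small = ℤ.i-j≡0⇒i≡j i j (trans eq (cong (ℤ._* + m) e≡0))
  where
  ∣e∣*m<m : ℤ.∣ e ∣ * m < 1 * m
  ∣e∣*m<m = begin-strict
    ℤ.∣ e ∣ * m         ≡⟨ ℤ.abs-* e (+ m) ⟨
    ℤ.∣ e ℤ.* + m ∣     ≡⟨ cong ℤ.∣_∣ eq ⟨
    ℤ.∣ i ℤ.- j ∣       ≤⟨ ℤ.∣i-j∣≤∣i∣+∣j∣ i j ⟩
    ℤ.∣ i ∣ + ℤ.∣ j ∣   <⟨ small ⟩
    m                   ≡⟨ *-identityˡ m ⟨
    1 * m               ∎
    where open ≤-Reasoning
  e≡0 : e ≡ 0ℤ
  e≡0 = ℤ.∣i∣≡0⇒i≡0 (n<1⇒n≡0 (*-cancelʳ-< m _ _ ∣e∣*m<m))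

-- With |i| and |j| below m / R and q + q′ at most R, the two products have absolute values summing
-- to less than m, which leaves no room for a nonzero multiple of m between them. It serves both for
-- two primes acting on one pair of points and for the common integer in `quotients-near`.
congruent-multiples : ∀ {m q q′ R} {i j e : ℤ} → 0 < q → q + q′ ≤ R → R * ℤ.∣ i ∣ < m → R * ℤ.∣ j ∣ < m →
  + q ℤ.* i ℤ.- + q′ ℤ.* j ≡ e ℤ.* + m → + q ℤ.* i ≡ + q′ ℤ.* j
congruent-multiples {m} {q@(suc _)} {q′} {R} {i} {j} {e} 0<q q+q′≤R i-small j-small eq =
  congruent-small {e = e} eq (*-cancelˡ-< R _ _ (begin-strict
    R * (ℤ.∣ + q ℤ.* i ∣ + ℤ.∣ + q′ ℤ.* j ∣)      ≡⟨ cong₂ (λ u v → R * (u + v)) (ℤ.abs-* (+ q) i) (ℤ.abs-* (+ q′) j) ⟩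
    R * (q * ℤ.∣ i ∣ + q′ * ℤ.∣ j ∣)              ≡⟨ solve 5 (λ R q q′ i j → R :* (q :* i :+ q′ :* j) := q :* (R :* i) :+ q′ :* (R :* j)) refl R q q′ ℤ.∣ i ∣ ℤ.∣ j ∣ ⟩
    q * (R * ℤ.∣ i ∣) + q′ * (R * ℤ.∣ j ∣)        <⟨ +-mono-<-≤ (*-monoʳ-< q i-small) (*-monoʳ-≤ q′ (<⇒≤ j-small)) ⟩
    q * m + q′ * m                                ≡⟨ *-distribʳ-+ m q q′ ⟨
    (q + q′) * m                                  ≤⟨ *-monoˡ-≤ m q+q′≤R ⟩
    R * m                                         ∎))
  where
  open ≤-Reasoning
  open +-*-Solver

private
  crossMultiplyᶻ : ∀ p q y y′ k k′ l l′ M →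
    p ℤ.* ((q ℤ.* y ℤ.- l ℤ.* M) ℤ.- (q ℤ.* y′ ℤ.- l′ ℤ.* M)) ℤ.- q ℤ.* ((p ℤ.* y ℤ.- k ℤ.* M) ℤ.- (p ℤ.* y′ ℤ.- k′ ℤ.* M))
    ≡ (q ℤ.* (k ℤ.- k′) ℤ.- p ℤ.* (l ℤ.- l′)) ℤ.* M
  crossMultiplyᶻ = ℤSolver.solve-∀

  regroupᶻ : ∀ q r b t m x u →
    q ℤ.* ((r ℤ.* b ℤ.- t ℤ.* m) ℤ.* x ℤ.- u ℤ.* m) ≡ (q ℤ.* r) ℤ.* (b ℤ.* x) ℤ.- (q ℤ.* t ℤ.* x ℤ.+ q ℤ.* u) ℤ.* m
  regroupᶻ = ℤSolver.solve-∀

  collectᶻ : ∀ q k b t m x u →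
    (+ 1 ℤ.+ k ℤ.* m) ℤ.* (b ℤ.* x) ℤ.- (q ℤ.* t ℤ.* x ℤ.+ q ℤ.* u) ℤ.* m
    ≡ b ℤ.* x ℤ.+ (k ℤ.* b ℤ.* x ℤ.- q ℤ.* t ℤ.* x ℤ.- q ℤ.* u) ℤ.* m
  collectᶻ = ℤSolver.solve-∀

  addSubᶻ : ∀ r k → r ≡ r ℤ.+ k ℤ.- k
  addSubᶻ = ℤSolver.solve-∀

  cancelAddᶻ : ∀ r s k → (r ℤ.+ k) ℤ.- (s ℤ.+ k) ≡ r ℤ.- s
  cancelAddᶻ = ℤSolver.solve-∀

  distribSubᶻ : ∀ k a b → k ℤ.* (a ℤ.- b) ≡ k ℤ.* a ℤ.- k ℤ.* b
  distribSubᶻ = ℤSolver.solve-∀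

∣∧<⇒≡0 : ∀ {p d} → p ∣ d → d < p → d ≡ 0
∣∧<⇒≡0 {d = zero} _ _ = refl
∣∧<⇒≡0 {d = suc _} p∣d d<p = contradiction (∣⇒≤ p∣d) (<⇒≱ d<p)

module _ {m : ℕ} .{{m≢0 : NonZero m}} where

  divMod : ∀ a → + a ≡ + (a % m) ℤ.+ + (a / m) ℤ.* + m
  divMod a = begin
    + a                                    ≡⟨ cong +_ (m≡m%n+[m/n]*n a m) ⟩
    + (a % m + a / m * m)                  ≡⟨ ℤ.pos-+ (a % m) _ ⟩
    + (a % m) ℤ.+ + (a / m * m)            ≡⟨ cong (λ u → + (a % m) ℤ.+ u) (ℤ.pos-* (a / m) m) ⟩
    + (a % m) ℤ.+ + (a / m) ℤ.* + m        ∎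
    where open ≡-Reasoning

  remainder≡ : ∀ a → + (a % m) ≡ + a ℤ.- + (a / m) ℤ.* + m
  remainder≡ a = begin
    + (a % m)                                                        ≡⟨ addSubᶻ (+ (a % m)) (+ (a / m) ℤ.* + m) ⟩
    + (a % m) ℤ.+ + (a / m) ℤ.* + m ℤ.- + (a / m) ℤ.* + m            ≡⟨ cong (ℤ._- + (a / m) ℤ.* + m) (sym (divMod a)) ⟩
    + a ℤ.- + (a / m) ℤ.* + m                                        ∎
    where
    open ≡-Reasoning

  sameQuotient⇒dist : ∀ a b → a / m ≡ b / m → dist a b ≡ dist (a % m) (b % m)
  sameQuotient⇒dist a b eq = cong ℤ.∣_∣ (begin
    + a ℤ.- + b                                                   ≡⟨ cong₂ ℤ._-_ (divMod a) (divMod b) ⟩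
    (+ (a % m) ℤ.+ + (a / m) ℤ.* + m) ℤ.- (+ (b % m) ℤ.+ + (b / m) ℤ.* + m)
      ≡⟨ cong (λ k → (+ (a % m) ℤ.+ + (a / m) ℤ.* + m) ℤ.- (+ (b % m) ℤ.+ + k ℤ.* + m)) (sym eq) ⟩
    (+ (a % m) ℤ.+ + (a / m) ℤ.* + m) ℤ.- (+ (b % m) ℤ.+ + (a / m) ℤ.* + m)
      ≡⟨ cancelAddᶻ (+ (a % m)) (+ (b % m)) (+ (a / m) ℤ.* + m) ⟩
    + (a % m) ℤ.- + (b % m)                                       ∎)
    where
    open ≡-Reasoning

  *-dist : ∀ k a b → k * dist a b ≡ dist (k * a) (k * b)
  *-dist k a b = begin
    k * ℤ.∣ + a ℤ.- + b ∣               ≡⟨ ℤ.abs-* (+ k) (+ a ℤ.- + b) ⟨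
    ℤ.∣ + k ℤ.* (+ a ℤ.- + b) ∣         ≡⟨ cong ℤ.∣_∣ (distribSubᶻ (+ k) (+ a) (+ b)) ⟩
    ℤ.∣ + k ℤ.* + a ℤ.- + k ℤ.* + b ∣   ≡⟨ cong₂ (λ u v → ℤ.∣ u ℤ.- v ∣) (sym (ℤ.pos-* k a)) (sym (ℤ.pos-* k b)) ⟩
    dist (k * a) (k * b)                ∎
    where
    open ≡-Reasoning

  sameQuotient⇒near : ∀ n a b → (n * a) / m ≡ (n * b) / m → n * dist a b < m
  sameQuotient⇒near n a b eq = subst (_< m)
    (sym (trans (*-dist n a b) (sameQuotient⇒dist (n * a) (n * b) eq)))
    (dist< (m%n<n (n * a) m) (m%n<n (n * b) m))

  -- Within one class, multiplication by `p` does not wrap around the modulus differently for the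
  -- two points, so their residues differ by exactly p times their distance; sharing a bin keeps
  -- that below m / n.
  sameClass⇒near : ∀ n p {y y′} → (p * y) / m ≡ (p * y′) / m →
    (n * ((p * y) % m)) / m ≡ (n * ((p * y′) % m)) / m → n * (p * dist y y′) < m
  sameClass⇒near n p {y} {y′} class≡ bin≡ = subst (λ d → n * d < m)
    (sym (trans (*-dist p y y′) (sameQuotient⇒dist (p * y) (p * y′) class≡)))
    (sameQuotient⇒near n _ _ bin≡)

  class< : ∀ {p y} → y < m → 0 < p → (p * y) / m < p
  class< {p@(suc _)} {y} y<m 0<p = m<n*o⇒m/o<n (*-monoʳ-< p y<m)

  -- Let A - A′ and B - B′ be the differences of the residues under p and q, both below m / n. Then
  -- p (B - B′) and q (A - A′) are congruent modulo m, and p + q ≤ n forces equality. Hence the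
  -- quotients satisfy q (k - k′) = p (l - l′), so p divides k - k′; but both k and k′ are below p.
  sameBins⇒sameClass : ∀ {n p q y y′} → Prime p → Prime q → p ≢ q → p + q ≤ n → y < m → y′ < m →
    (n * ((p * y) % m)) / m ≡ (n * ((p * y′) % m)) / m →
    (n * ((q * y) % m)) / m ≡ (n * ((q * y′) % m)) / m →
    (p * y) / m ≡ (p * y′) / m
  sameBins⇒sameClass {n} {p} {q} {y} {y′} pp pq p≢q p+q≤n y<m y′<m binₚ bin_q = dist≡0⇒≡ d≡0
    where
    A = + ((p * y) % m)
    A′ = + ((p * y′) % m)
    B = + ((q * y) % m)
    B′ = + ((q * y′) % m)
    k = (p * y) / m
    k′ = (p * y′) / m
    l = (q * y) / m
    l′ = (q * y′) / m
    M = + m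
    e = + q ℤ.* (+ k ℤ.- + k′) ℤ.- + p ℤ.* (+ l ℤ.- + l′)
    0<p = ≤-trans (s≤s z≤n) (2≤prime pp)
    rem : ∀ c x → + ((c * x) % m) ≡ + c ℤ.* + x ℤ.- + ((c * x) / m) ℤ.* M
    rem c x = trans (remainder≡ (c * x)) (cong (ℤ._- + ((c * x) / m) ℤ.* M) (ℤ.pos-* c x))
    congruence : + p ℤ.* (B ℤ.- B′) ℤ.- + q ℤ.* (A ℤ.- A′) ≡ e ℤ.* M
    congruence = begin
      + p ℤ.* (B ℤ.- B′) ℤ.- + q ℤ.* (A ℤ.- A′)
        ≡⟨ cong₂ (λ u v → + p ℤ.* u ℤ.- + q ℤ.* v) (cong₂ ℤ._-_ (rem q y) (rem q y′)) (cong₂ ℤ._-_ (rem p y) (rem p y′)) ⟩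
      + p ℤ.* ((+ q ℤ.* + y ℤ.- + l ℤ.* M) ℤ.- (+ q ℤ.* + y′ ℤ.- + l′ ℤ.* M))
        ℤ.- + q ℤ.* ((+ p ℤ.* + y ℤ.- + k ℤ.* M) ℤ.- (+ p ℤ.* + y′ ℤ.- + k′ ℤ.* M))
        ≡⟨ crossMultiplyᶻ (+ p) (+ q) (+ y) (+ y′) (+ k) (+ k′) (+ l) (+ l′) M ⟩
      e ℤ.* M ∎
      where
      open ≡-Reasoning
    multiples≡ : + p ℤ.* (B ℤ.- B′) ≡ + q ℤ.* (A ℤ.- A′)
    multiples≡ = congruent-multiples {R = n} {e = e} 0<p p+q≤n (sameQuotient⇒near n _ _ bin_q) (sameQuotient⇒near n _ _ binₚ) congruence
    instance
      M≢0 : ℤ.NonZero M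
      M≢0 = ≢-nonZero (≢-nonZero⁻¹ m)
    eM≡0 : e ℤ.* M ≡ 0ℤ
    eM≡0 = trans (sym congruence) (ℤ.i≡j⇒i-j≡0 multiples≡)
    e≡0 : e ≡ 0ℤ
    e≡0 = ℤ.*-cancelʳ-≡ e 0ℤ M eM≡0
    qk≡pl : q * dist k k′ ≡ dist l l′ * p
    qk≡pl = begin
      q * dist k k′                          ≡⟨ ℤ.abs-* (+ q) (+ k ℤ.- + k′) ⟨
      ℤ.∣ + q ℤ.* (+ k ℤ.- + k′) ∣           ≡⟨ cong ℤ.∣_∣ (ℤ.i-j≡0⇒i≡j (+ q ℤ.* (+ k ℤ.- + k′)) (+ p ℤ.* (+ l ℤ.- + l′)) e≡0) ⟩
      ℤ.∣ + p ℤ.* (+ l ℤ.- + l′) ∣           ≡⟨ ℤ.abs-* (+ p) (+ l ℤ.- + l′) ⟩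
      p * dist l l′                          ≡⟨ *-comm p _ ⟩
      dist l l′ * p                          ∎
      where open ≡-Reasoning
    p∣d : p ∣ dist k k′
    p∣d = [ (λ p∣q → contradiction (prime∣prime pp pq p∣q) p≢q) , (λ h → h) ]′
      (euclidsLemma q (dist k k′) pp (divides (dist l l′) qk≡pl))
    d<p : dist k k′ < p
    d<p = dist< (class< y<m 0<p) (class< y′<m 0<p)
    d≡0 : dist k k′ ≡ 0
    d≡0 = ∣∧<⇒≡0 p∣d d<p

  -- Multiplication by q undoes r up to multiples of m, whatever the two reductions have removed.
  -- The cofactor lives in ℤ because it may be negative.
  modInverse-cancel : ∀ {q r} → ModInverse m q r → ∀ b x →
    ∃[ e ] + (q * (((r * b) % m * x) % m)) ≡ + (b * x) ℤ.+ e ℤ.* + m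
  modInverse-cancel {q} {r} (k , eq) b x =
    + k ℤ.* + b ℤ.* + x ℤ.- + q ℤ.* + t ℤ.* + x ℤ.- + q ℤ.* + u , (begin
    + (q * (s * x % m))
      ≡⟨ ℤ.pos-* q _ ⟩
    + q ℤ.* + (s * x % m)
      ≡⟨ cong (λ v → + q ℤ.* v) (trans (remainder≡ (s * x)) (cong (ℤ._- + u ℤ.* + m) (trans (ℤ.pos-* s x)
           (cong (ℤ._* + x) (trans (remainder≡ (r * b)) (cong (ℤ._- + t ℤ.* + m) (ℤ.pos-* r b))))))) ⟩
    + q ℤ.* ((+ r ℤ.* + b ℤ.- + t ℤ.* + m) ℤ.* + x ℤ.- + u ℤ.* + m)
      ≡⟨ regroupᶻ (+ q) (+ r) (+ b) (+ t) (+ m) (+ x) (+ u) ⟩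
    (+ q ℤ.* + r) ℤ.* (+ b ℤ.* + x) ℤ.- (+ q ℤ.* + t ℤ.* + x ℤ.+ + q ℤ.* + u) ℤ.* + m
      ≡⟨ cong (λ v → v ℤ.* (+ b ℤ.* + x) ℤ.- (+ q ℤ.* + t ℤ.* + x ℤ.+ + q ℤ.* + u) ℤ.* + m) qr≡ ⟩
    (+ 1 ℤ.+ + k ℤ.* + m) ℤ.* (+ b ℤ.* + x) ℤ.- (+ q ℤ.* + t ℤ.* + x ℤ.+ + q ℤ.* + u) ℤ.* + m
      ≡⟨ collectᶻ (+ q) (+ k) (+ b) (+ t) (+ m) (+ x) (+ u) ⟩
    + b ℤ.* + x ℤ.+ (+ k ℤ.* + b ℤ.* + x ℤ.- + q ℤ.* + t ℤ.* + x ℤ.- + q ℤ.* + u) ℤ.* + m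
      ≡⟨ cong (ℤ._+ (+ k ℤ.* + b ℤ.* + x ℤ.- + q ℤ.* + t ℤ.* + x ℤ.- + q ℤ.* + u) ℤ.* + m) (sym (ℤ.pos-* b x)) ⟩
    + (b * x) ℤ.+ (+ k ℤ.* + b ℤ.* + x ℤ.- + q ℤ.* + t ℤ.* + x ℤ.- + q ℤ.* + u) ℤ.* + m ∎)
    where
    open ≡-Reasoning
    s = (r * b) % m
    t = (r * b) / m
    u = (s * x) / m
    qr≡ : + q ℤ.* + r ≡ + 1 ℤ.+ + k ℤ.* + m
    qr≡ = begin
      + q ℤ.* + r             ≡⟨ ℤ.pos-* q r ⟨
      + (q * r)               ≡⟨ cong +_ eq ⟩
      + (1 + k * m)           ≡⟨ ℤ.pos-+ 1 (k * m) ⟩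
      + 1 ℤ.+ + (k * m)       ≡⟨ cong (λ v → + 1 ℤ.+ v) (ℤ.pos-* k m) ⟩
      + 1 ℤ.+ + k ℤ.* + m     ∎

-- Pairs produced by the rich multiples of one unit

1≤*⇒1≤ˡ : ∀ {a b} → 1 ≤ a * b → 1 ≤ a
1≤*⇒1≤ˡ {suc a} _ = s≤s z≤n

1≤*⇒1≤ʳ : ∀ {a b} → 1 ≤ a * b → 1 ≤ b
1≤*⇒1≤ʳ {a} {b} h = 1≤*⇒1≤ˡ {b} {a} (subst (1 ≤_) (*-comm a b) h)

∑>0⇒∃ : (f : I → ℕ) (xs : List I) → 1 ≤ ∑ xs f → ∃[ x ] x ∈ xs × 1 ≤ f x
∑>0⇒∃ f (x ∷ xs) h with f x in eq
... | suc k = x , here refl , subst (1 ≤_) (sym eq) (s≤s z≤n)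
... | zero with ∑>0⇒∃ f xs h
...   | y , y∈xs , 1≤fy = y , there y∈xs , 1≤fy

∑-𝟙≡ : (y : ℕ) {ys : List ℕ} → Unique ys → ∑ ys (λ z → 𝟙 (z ≟ y)) ≤ 1
∑-𝟙≡ y {ys} u = subst (_≤ 1) (length-filter-∑ (_≟ y) ys)
  (length-image {ys = y ∷ []} id (filter⁺ (_≟ y) u) (λ z∈ → here (proj₂ (∈-filter⁻ (_≟ y) {xs = ys} z∈))) (λ _ _ → id))

positive : ℕ → ℕ
positive c = 𝟙 (1 ≤? c)

∑-cartesianProduct : (f : I × E → ℕ) (xs : List I) (ys : List E) →
  ∑ (cartesianProduct xs ys) f ≡ ∑ xs (λ x → ∑ ys (λ y → f (x , y)))
∑-cartesianProduct f [] ys = refl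
∑-cartesianProduct f (x ∷ xs) ys = trans (∑-++ f (map (x ,_) ys) _)
  (cong₂ _+_ (∑-map f (x ,_) ys) (∑-cartesianProduct f xs ys))

-- The second elementary symmetric polynomial in the values of `v`.
pairSum : List I → (I → ℕ) → ℕ
pairSum [] v = 0
pairSum (p ∷ ps) v = v p * ∑ ps v + pairSum ps v

-- The square is its diagonal plus twice `pairSum`, and a diagonal term `a * a` is at most `M * a`.
square≤ : ∀ {M} (v : I → ℕ) (ps : List I) → (∀ {p} → p ∈ ps → v p ≤ M) →
  ∑ ps v * ∑ ps v ≤ M * ∑ ps v + 2 * pairSum ps v
square≤ v [] _ = z≤n
square≤ {M = M} v (p ∷ ps) v≤M = begin
  (a + S) * (a + S)                           ≡⟨ expand a S ⟩
  a * a + 2 * (a * S) + S * S                 ≤⟨ +-mono-≤ (+-monoˡ-≤ (2 * (a * S)) (*-monoˡ-≤ a (v≤M (here refl)))) (square≤ v ps (v≤M ∘ there)) ⟩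
  M * a + 2 * (a * S) + (M * S + 2 * O)       ≡⟨ collect′ M a S O ⟩
  M * (a + S) + 2 * (a * S + O)               ∎
  where
  open ≤-Reasoning
  a = v p
  S = ∑ ps v
  O = pairSum ps v
  expand : ∀ a S → (a + S) * (a + S) ≡ a * a + 2 * (a * S) + S * S
  expand = solve-∀
  collect′ : ∀ M a S O → M * a + 2 * (a * S) + (M * S + 2 * O) ≡ M * (a + S) + 2 * (a * S + O)
  collect′ = solve-∀

2ab≤a²+b² : ∀ a b → 2 * (a * b) ≤ a * a + b * b
2ab≤a²+b² a b with ≤-total a b
... | inj₁ a≤b = subst (λ b → 2 * (a * b) ≤ a * a + b * b) (m+[n∸m]≡n a≤b) (shifted a (b ∸ a))
  where
  identity : ∀ a d → 2 * (a * (a + d)) + d * d ≡ a * a + (a + d) * (a + d)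
  identity = solve-∀
  shifted : ∀ a d → 2 * (a * (a + d)) ≤ a * a + (a + d) * (a + d)
  shifted a d = ≤-trans (m≤m+n _ (d * d)) (≤-reflexive (identity a d))
... | inj₂ b≤a = subst (λ a → 2 * (a * b) ≤ a * a + b * b) (m+[n∸m]≡n b≤a) (shifted b (a ∸ b))
  where
  identity : ∀ b d → 2 * ((b + d) * b) + d * d ≡ (b + d) * (b + d) + b * b
  identity = solve-∀
  shifted : ∀ b d → 2 * ((b + d) * b) ≤ (b + d) * (b + d) + b * b
  shifted b d = ≤-trans (m≤m+n _ (d * d)) (≤-reflexive (identity b d))

-- Combine (W − M)² ≥ 0 for W = ∑ v with W² ≤ M W + 2 pairSum v.
bonferroni : ∀ {M} (v : I → ℕ) (ps : List I) → (∀ {p} → p ∈ ps → v p ≤ M) →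
  M * ∑ ps v ≤ M * M * positive (∑ ps v) + 2 * pairSum ps v
bonferroni {M = M} v ps v≤M with ∑ ps v | square≤ v ps v≤M
... | zero | _ = ≤-trans (≤-reflexive (*-zeroʳ M)) z≤n
... | S@(suc _) | S²≤ = +-cancelˡ-≤ (M * S) _ _ (begin
  M * S + M * S                      ≡⟨ double (M * S) ⟩
  2 * (M * S)                        ≤⟨ 2ab≤a²+b² M S ⟩
  M * M + S * S                      ≤⟨ +-monoʳ-≤ (M * M) S²≤ ⟩
  M * M + (M * S + 2 * O)            ≡⟨ rearrange (M * M) (M * S) (2 * O) ⟩
  M * S + (M * M * 1 + 2 * O)        ∎)
  where
  open ≤-Reasoning
  O = pairSum ps v
  double : ∀ a → a + a ≡ 2 * a
  double = solve-∀
  rearrange : ∀ a b c → a + (b + c) ≡ b + (a * 1 + c)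
  rearrange = solve-∀

-- There are l (l - 1) / 2 pairs from a list of length l; the factor 2 in the hypothesis cancels the
-- one half.
∑-pairSum : ∀ {K} (es : List E) (ps : List I) (w : I → E → ℕ) →
  AllPairs (λ p q → ∑ es (λ e → w p e * w q e) ≤ 2 * K) ps →
  ∑ es (λ e → pairSum ps (λ p → w p e)) ≤ length ps * length ps * K
∑-pairSum es [] w [] = ≤-reflexive (∑-zero es)
∑-pairSum {K = K} es (p ∷ ps) w (h ∷ hs) = begin
  ∑ es (λ e → w p e * ∑ ps (λ q → w q e) + pairSum ps (λ q → w q e))
    ≡⟨ ∑-+ _ _ es ⟩
  ∑ es (λ e → w p e * ∑ ps (λ q → w q e)) + ∑ es (λ e → pairSum ps (λ q → w q e))
    ≡⟨ cong (_+ ∑ es (λ e → pairSum ps (λ q → w q e))) (trans (∑-cong (λ e → sym (∑-*ˡ (w p e) (λ q → w q e) ps)) es) (∑-swap es ps (λ e q → w p e * w q e))) ⟩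
  ∑ ps (λ q → ∑ es (λ e → w p e * w q e)) + ∑ es (λ e → pairSum ps (λ q → w q e))
    ≤⟨ +-mono-≤ (∑-≤-const ps (All.lookup h)) (∑-pairSum es ps w hs) ⟩
  length ps * (2 * K) + length ps * length ps * K
    ≤⟨ m≤m+n _ K ⟩
  length ps * (2 * K) + length ps * length ps * K + K
    ≡⟨ square (length ps) K ⟩
  suc (length ps) * suc (length ps) * K ∎
  where
  open ≤-Reasoning
  square : ∀ l K → l * (2 * K) + l * l * K + K ≡ (1 + l) * (1 + l) * K
  square = solve-∀

-- Summing `bonferroni` over `es` gives a weighted form of inclusion and exclusion: the supports of
-- the weights have a large union if the weights are large in total and their pairwise products are
-- small.
weighted-union : ∀ {M K} (es : List E) (ps : List I) (w : I → E → ℕ) →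
  (∀ {p} e → p ∈ ps → w p e ≤ M) →
  AllPairs (λ p q → ∑ es (λ e → w p e * w q e) ≤ 2 * K) ps →
  M * ∑ ps (λ p → ∑ es (w p)) ≤
    M * M * ∑ es (λ e → positive (∑ ps (λ p → w p e))) + 2 * (length ps * length ps * K)
weighted-union {M = M} {K} es ps w w≤M small = begin
  M * ∑ ps (λ p → ∑ es (w p))                    ≡⟨ cong (M *_) (∑-swap ps es w) ⟩
  M * ∑ es (λ e → ∑ ps (λ p → w p e))            ≡⟨ ∑-*ˡ M _ es ⟨
  ∑ es (λ e → M * ∑ ps (λ p → w p e))            ≤⟨ ∑-mono es (λ {e} _ → bonferroni (λ p → w p e) ps (w≤M e)) ⟩
  ∑ es (λ e → M * M * positive (∑ ps (λ p → w p e)) + 2 * pairSum ps (λ p → w p e))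
    ≡⟨ trans (∑-+ _ _ es) (cong₂ _+_ (∑-*ˡ (M * M) _ es) (∑-*ˡ 2 _ es)) ⟩
  M * M * ∑ es (λ e → positive (∑ ps (λ p → w p e))) + 2 * ∑ es (λ e → pairSum ps (λ p → w p e))
    ≤⟨ +-monoʳ-≤ (M * M * ∑ es (λ e → positive (∑ ps (λ p → w p e)))) (*-monoʳ-≤ 2 (∑-pairSum {K = K} es ps w small)) ⟩
  M * M * ∑ es (λ e → positive (∑ ps (λ p → w p e))) + 2 * (length ps * length ps * K) ∎
  where open ≤-Reasoning

-- Every point of a class distributes the weight N! evenly over its c neighbours, so that large classes are not overcounted;
-- the factor N! keeps the shares integral.
shareOf : ℕ → ℕ → ℕ
shareOf N zero = 0
shareOf N c@(suc _) = N ! / c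

shareOf≤ : ∀ N c → shareOf N c ≤ N !
shareOf≤ N zero = z≤n
shareOf≤ N c@(suc _) = m/n≤m (N !) c

*-shareOf : ∀ {N} c → c ≤ N → c * shareOf N c ≡ N ! * positive c
*-shareOf {N} zero _ = sym (*-zeroʳ (N !))
*-shareOf {N} (suc c) c<N = trans (m*[n/m]≡n (∣-trans (m∣m*n (c !)) (m≤n⇒m!∣n! c<N))) (sym (*-identityʳ (N !)))

-- Near pairs and the graphs of the rich bins

Near : (m R : ℕ) → ℕ → ℕ → Set
Near m R y y′ = (y ≢ y′) × (R * dist y y′ < m)

near? : ∀ m R y y′ → Dec (Near m R y y′)
near? m R y y′ = ¬? (y ≟ y′) ×-dec (R * dist y y′ <? m)

nearPairs : (m R : ℕ) → List ℕ → ℕ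
nearPairs m R ys = ∑ ys (λ y → ∑ ys (λ y′ → 𝟙 (near? m R y y′)))

module RichMultipliers {m : ℕ} .{{m≢0 : NonZero m}} (n : ℕ) (β : ℕ → ℕ)
  {ys : List ℕ} (ys-unique : Unique ys) (ys<m : ∀ {y} → y ∈ ys → y < m) where

  InBin : ℕ → ℕ → Set
  InBin p y = (n * ((p * y) % m)) / m ≡ β p

  inBin? : ∀ p y → Dec (InBin p y)
  inBin? p y = (n * ((p * y) % m)) / m ≟ β p

  -- For each `p` this graph is a disjoint union of cliques, one for each class that meets the bin
  -- `β p`.
  Edge : ℕ → ℕ → ℕ → Set
  Edge p y y′ = (y ≢ y′) × InBin p y × InBin p y′ × ((p * y) / m ≡ (p * y′) / m)

  edge? : ∀ p y y′ → Dec (Edge p y y′)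
  edge? p y y′ = ¬? (y ≟ y′) ×-dec inBin? p y ×-dec inBin? p y′ ×-dec ((p * y) / m ≟ (p * y′) / m)

  N = length ys
  M = N !

  degree : ℕ → ℕ → ℕ
  degree p y = ∑ ys (λ y′ → 𝟙 (edge? p y y′))

  weight : ℕ → ℕ × ℕ → ℕ
  weight p (y , y′) = 𝟙 (edge? p y y′) * shareOf N (degree p y)

  degree≤N : ∀ p y → degree p y ≤ N
  degree≤N p y = ≤-trans (∑-≤-const ys (λ {y′} _ → 𝟙≤1 (edge? p y y′))) (≤-reflexive (*-identityʳ N))

  weight≤M : ∀ p e → weight p e ≤ M
  weight≤M p (y , y′) = ≤-trans (*-mono-≤ (𝟙≤1 (edge? p y y′)) (shareOf≤ N (degree p y))) (≤-reflexive (*-identityˡ M))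

  pairs = cartesianProduct ys ys

  -- A point with at least one neighbour hands out exactly `M`, since its degree is at most `N` and
  -- so divides `M`.
  totalWeight : ∀ p → ∑ pairs (weight p) ≡ M * ∑ ys (λ y → positive (degree p y))
  totalWeight p = begin
    ∑ pairs (weight p)                                   ≡⟨ ∑-cartesianProduct (weight p) ys ys ⟩
    ∑ ys (λ y → ∑ ys (λ y′ → weight p (y , y′)))         ≡⟨ ∑-cong (λ y → trans (∑-*ʳ (shareOf N (degree p y)) _ ys) (*-shareOf (degree p y) (degree≤N p y))) ys ⟩
    ∑ ys (λ y → M * positive (degree p y))               ≡⟨ ∑-*ˡ M _ ys ⟩
    M * ∑ ys (λ y → positive (degree p y))               ∎
    where open ≡-Reasoning

  Isolated : ℕ → ℕ → Set
  Isolated p y = InBin p y × degree p y ≡ 0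

  isolated? : ∀ p y → Dec (Isolated p y)
  isolated? p y = inBin? p y ×-dec (degree p y ≟ 0)

  -- Two points of the bin in the same class would be adjacent, so isolated points occupy different
  -- classes, of which there are p.
  isolated-count : ∀ {p} → 0 < p → ∑ ys (λ y → 𝟙 (isolated? p y)) ≤ p
  isolated-count {p} 0<p = subst₂ _≤_ (length-filter-∑ (isolated? p) ys) (length-upTo p)
    (length-image (λ y → (p * y) / m) (filter⁺ (isolated? p) ys-unique)
      (λ y∈ → ∈-upTo⁺ (class< (ys<m (proj₁ (split y∈))) 0<p)) injective)
    where
    split : ∀ {y} → y ∈ filter (isolated? p) ys → y ∈ ys × Isolated p y
    split = ∈-filter⁻ (isolated? p) {xs = ys}
    injective : ∀ {y y′} → y ∈ filter (isolated? p) ys → y′ ∈ filter (isolated? p) ys →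
      (p * y) / m ≡ (p * y′) / m → y ≡ y′
    injective {y} {y′} y∈ y′∈ class≡ with y ≟ y′
    ... | yes y≡y′ = y≡y′
    ... | no y≢y′ with split y∈ | split y′∈
    ...   | _ , bin , deg≡0 | y′∈ys , bin′ , _ =
      contradiction (subst (_≤ 0) (𝟙-yes (edge? p y y′) (y≢y′ , bin , bin′ , class≡))
        (≤-trans (∈⇒≤∑ (λ z → 𝟙 (edge? p y z)) y′∈ys) (≤-reflexive deg≡0))) λ ()

  -- At most p of the points in the bin are isolated, and each of the others contributes `M`.
  totalWeight-lower : ∀ {p L} → 0 < p → L ≤ ∑ ys (λ y → 𝟙 (inBin? p y)) → M * (L ∸ p) ≤ ∑ pairs (weight p)
  totalWeight-lower {p} {L} 0<p L≤ = subst (M * (L ∸ p) ≤_) (sym (totalWeight p)) (*-monoʳ-≤ M (m≤n+o⇒m∸n≤o L p (begin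
    L                                                                  ≤⟨ L≤ ⟩
    ∑ ys (λ y → 𝟙 (inBin? p y))                                        ≤⟨ ∑-mono ys (λ {y} _ → split y) ⟩
    ∑ ys (λ y → 𝟙 (isolated? p y) + positive (degree p y))             ≡⟨ ∑-+ _ _ ys ⟩
    ∑ ys (λ y → 𝟙 (isolated? p y)) + ∑ ys (λ y → positive (degree p y)) ≤⟨ +-monoˡ-≤ _ (isolated-count 0<p) ⟩
    p + ∑ ys (λ y → positive (degree p y))                             ∎)))
    where
    open ≤-Reasoning
    split : ∀ y → 𝟙 (inBin? p y) ≤ 𝟙 (isolated? p y) + positive (degree p y)
    split y = 𝟙-bound (inBin? p y) λ bin → cases bin (degree p y ≟ 0)
      where
      cases : InBin p y → Dec (degree p y ≡ 0) → 1 ≤ 𝟙 (isolated? p y) + positive (degree p y)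
      cases bin (yes deg≡0) = ≤-trans (≤-reflexive (sym (𝟙-yes (isolated? p y) (bin , deg≡0)))) (m≤m+n _ _)
      cases bin (no deg≢0) = ≤-trans (≤-reflexive (sym (𝟙-yes (1 ≤? degree p y) (n≢0⇒n>0 deg≢0)))) (m≤n+m _ _)

  module _ {p q : ℕ} (pp : Prime p) (pq : Prime q) (p≢q : p ≢ q) (p+q≤n : p + q ≤ n) where

    common : ℕ → ℕ
    common y = ∑ ys (λ y′ → 𝟙 (edge? p y y′) * 𝟙 (edge? q y y′))

    common≤degreeˡ : ∀ y → common y ≤ degree p y
    common≤degreeˡ y = ∑-mono ys (λ {y′} _ →
      ≤-trans (*-monoʳ-≤ (𝟙 (edge? p y y′)) (𝟙≤1 (edge? q y y′))) (≤-reflexive (*-identityʳ _)))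

    common≤degreeʳ : ∀ y → common y ≤ degree q y
    common≤degreeʳ y = ∑-mono ys (λ {y′} _ →
      ≤-trans (*-monoˡ-≤ (𝟙 (edge? q y y′)) (𝟙≤1 (edge? p y y′))) (≤-reflexive (*-identityˡ _)))

    common⇒inBins : ∀ {y} → 1 ≤ common y → InBin p y × InBin q y
    common⇒inBins {y} h with ∑>0⇒∃ (λ y′ → 𝟙 (edge? p y y′) * 𝟙 (edge? q y y′)) ys h
    ... | y′ , _ , 1≤ = proj₁ (proj₂ (𝟙>0 (edge? p y y′) (1≤*⇒1≤ˡ 1≤))) , proj₁ (proj₂ (𝟙>0 (edge? q y y′) (1≤*⇒1≤ʳ {𝟙 (edge? p y y′)} 1≤)))

    shared? : ∀ y → Dec (1 ≤ common y)
    shared? y = 1 ≤? common y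

    shared = filter shared? ys

    -- All shared points lie in a single class modulo p, hence are adjacent to each other.
    shared-count : ∀ {y} → y ∈ shared → length shared ≤ 1 + degree p y
    shared-count {y} y∈ = begin
      length shared                                       ≡⟨ length-filter-∑ shared? ys ⟩
      ∑ ys (λ z → 𝟙 (shared? z))                          ≤⟨ ∑-mono ys adjacent ⟩
      ∑ ys (λ z → 𝟙 (z ≟ y) + 𝟙 (edge? p y z))            ≡⟨ ∑-+ _ _ ys ⟩
      ∑ ys (λ z → 𝟙 (z ≟ y)) + degree p y                 ≤⟨ +-monoˡ-≤ _ (∑-𝟙≡ y ys-unique) ⟩
      1 + degree p y                                      ∎
      where
      open ≤-Reasoning
      y∈ys = proj₁ (∈-filter⁻ shared? {xs = ys} y∈)
      binsʸ = common⇒inBins (proj₂ (∈-filter⁻ shared? {xs = ys} y∈))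
      adjacent : ∀ {z} → z ∈ ys → 𝟙 (shared? z) ≤ 𝟙 (z ≟ y) + 𝟙 (edge? p y z)
      adjacent {z} z∈ys = 𝟙-bound (shared? z) λ sh → cases (common⇒inBins sh) (z ≟ y)
        where
        cases : InBin p z × InBin q z → (d : Dec (z ≡ y)) → 1 ≤ 𝟙 d + 𝟙 (edge? p y z)
        cases _ (yes _) = s≤s z≤n
        cases (binₚ , bin_q) (no z≢y) = ≤-reflexive (sym (𝟙-yes (edge? p y z)
          (z≢y ∘ sym , proj₁ binsʸ , binₚ ,
           sameBins⇒sameClass pp pq p≢q p+q≤n (ys<m y∈ys) (ys<m z∈ys)
             (trans (proj₁ binsʸ) (sym binₚ)) (trans (proj₂ binsʸ) (sym bin_q)))))

    share : ℕ → ℕ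
    share y = shareOf N (degree p y)

    -- By `shared-count` the number of shared points is at most twice the degree, and degree times
    -- share is at most `M`. This is what `∑-average` asks for in `overlapWeight`.
    shared-share : ∀ {y} → y ∈ shared → length shared * share y ≤ 2 * M
    shared-share {y} y∈ = begin
      length shared * share y        ≤⟨ *-monoˡ-≤ (share y) (≤-trans (shared-count y∈) (+-monoˡ-≤ (degree p y) 1≤deg)) ⟩
      (degree p y + degree p y) * share y ≡⟨ double (degree p y) (share y) ⟩
      2 * (degree p y * share y)     ≡⟨ cong (2 *_) (*-shareOf (degree p y) (degree≤N p y)) ⟩
      2 * (M * positive (degree p y)) ≤⟨ *-monoʳ-≤ 2 (≤-trans (*-monoʳ-≤ M (𝟙≤1 (1 ≤? degree p y))) (≤-reflexive (*-identityʳ M))) ⟩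
      2 * M                          ∎
      where
      open ≤-Reasoning
      1≤deg : 1 ≤ degree p y
      1≤deg = ≤-trans (proj₂ (∈-filter⁻ shared? {xs = ys} y∈)) (common≤degreeˡ y)
      double : ∀ a b → (a + a) * b ≡ 2 * (a * b)
      double = solve-∀

    -- In the row of `y` there are at most `degree q y` common edges, so the shares for `q` add up
    -- to at most `M`, leaving `M * share y`. Averaging then bounds the sum of `share y` over the
    -- shared points by 2 M, however many there are.
    overlapWeight : ∑ pairs (λ e → weight p e * weight q e) ≤ 2 * (M * M)
    overlapWeight = begin
      ∑ pairs (λ e → weight p e * weight q e)                      ≡⟨ ∑-cartesianProduct _ ys ys ⟩
      ∑ ys (λ y → ∑ ys (λ y′ → weight p (y , y′) * weight q (y , y′))) ≤⟨ ∑-mono ys (λ {y} _ → row y) ⟩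
      ∑ ys (λ y → 𝟙 (shared? y) * (M * share y))                   ≡⟨ ∑-filter shared? (λ y → M * share y) ys ⟨
      ∑ shared (λ y → M * share y)                                 ≡⟨ ∑-*ˡ M share shared ⟩
      M * ∑ shared share                                           ≤⟨ *-monoʳ-≤ M (∑-average shared shared-share) ⟩
      M * (2 * M)                                                  ≡⟨ swap M ⟩
      2 * (M * M)                                                  ∎
      where
      open ≤-Reasoning
      swap : ∀ M → M * (2 * M) ≡ 2 * (M * M)
      swap = solve-∀
      interchange : ∀ a b c d → (a * b) * (c * d) ≡ (a * c) * (b * d)
      interchange = solve-∀
      assoc : ∀ a b c → a * (b * c) ≡ c * a * b
      assoc = solve-∀
      row : ∀ y → ∑ ys (λ y′ → weight p (y , y′) * weight q (y , y′)) ≤ 𝟙 (shared? y) * (M * share y)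
      row y = begin
        ∑ ys (λ y′ → weight p (y , y′) * weight q (y , y′))
          ≡⟨ trans (∑-cong (λ y′ → interchange (𝟙 (edge? p y y′)) (share y) (𝟙 (edge? q y y′)) share′) ys) (∑-*ʳ (share y * share′) _ ys) ⟩
        common y * (share y * share′)
          ≤⟨ bound (common y) refl ⟩
        𝟙 (shared? y) * (M * share y) ∎
        where
        share′ = shareOf N (degree q y)
        -- Generalised over the value of `common y` so that the indicator computes: a row without
        -- common edges vanishes.
        bound : ∀ c → common y ≡ c → c * (share y * share′) ≤ 𝟙 (1 ≤? c) * (M * share y)
        bound zero _ = z≤n
        bound c@(suc _) eq = begin
          c * (share y * share′)                     ≡⟨ trans (cong (c *_) (*-comm (share y) share′)) (sym (*-assoc c share′ (share y))) ⟩
          c * share′ * share y                       ≤⟨ *-monoˡ-≤ (share y) (*-monoˡ-≤ share′ (≤-trans (≤-reflexive (sym eq)) (common≤degreeʳ y))) ⟩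
          degree q y * share′ * share y              ≡⟨ cong (_* share y) (*-shareOf (degree q y) (degree≤N q y)) ⟩
          M * positive (degree q y) * share y        ≤⟨ *-monoˡ-≤ (share y) (≤-trans (*-monoʳ-≤ M (𝟙≤1 (1 ≤? degree q y))) (≤-reflexive (*-identityʳ M))) ⟩
          M * share y                                ≡⟨ +-identityʳ _ ⟨
          1 * (M * share y)                          ∎

  -- The support of the combined weights is bounded below by `weighted-union` and consists of near
  -- pairs. The scale `M` of the weights enters every term as M² and cancels.
  nearPairs-lower : ∀ {P P₀ L} {ps : List ℕ} → Unique ps → P + P ≤ n →
    (∀ {p} → p ∈ ps → Prime p × P₀ ≤ p × p ≤ P × L ≤ ∑ ys (λ y → 𝟙 (inBin? p y))) →
    length ps * (L ∸ P) ≤ nearPairs m (n * P₀) ys + 2 * (length ps * length ps)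
  nearPairs-lower {P} {P₀} {L} {ps} ps-unique 2P≤n h = *-cancelˡ-≤ (M * M) {{m*n≢0 M M}} (begin
    M * M * (t * (L ∸ P))
      ≡⟨ assoc M t (L ∸ P) ⟩
    M * (t * (M * (L ∸ P)))
      ≡⟨ cong (M *_) (∑-const (M * (L ∸ P)) ps) ⟨
    M * ∑ ps (λ _ → M * (L ∸ P))
      ≤⟨ *-monoʳ-≤ M (∑-mono ps λ p∈ → ≤-trans (*-monoʳ-≤ M (∸-monoʳ-≤ L (p≤P p∈))) (totalWeight-lower (0<p p∈) (proj₂ (proj₂ (proj₂ (h p∈)))))) ⟩
    M * ∑ ps (λ p → ∑ pairs (weight p))
      ≤⟨ weighted-union pairs ps weight (λ {p} e _ → weight≤M p e) (overlaps ps-unique (λ p∈ → p∈)) ⟩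
    M * M * ∑ pairs (λ e → positive (∑ ps (λ p → weight p e))) + 2 * (t * t * (M * M))
      -- A pair of positive combined weight is an edge for some p, and p ≥ P₀ makes it near at scale
      -- n P₀.
      ≤⟨ +-monoˡ-≤ _ (*-monoʳ-≤ (M * M) (∑-mono pairs (λ {e} _ → 𝟙-mono (1 ≤? _) (near? m (n * P₀) (proj₁ e) (proj₂ e)) (near e)))) ⟩
    M * M * ∑ pairs (λ e → 𝟙 (near? m (n * P₀) (proj₁ e) (proj₂ e))) + 2 * (t * t * (M * M))
      ≡⟨ cong (λ s → M * M * s + 2 * (t * t * (M * M))) (∑-cartesianProduct _ ys ys) ⟩
    M * M * nearPairs m (n * P₀) ys + 2 * (t * t * (M * M))
      ≡⟨ factor M (nearPairs m (n * P₀) ys) t ⟩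
    M * M * (nearPairs m (n * P₀) ys + 2 * (t * t)) ∎)
    where
    open ≤-Reasoning
    t = length ps
    instance
      M≢0 : NonZero M
      M≢0 = N !≢0
    assoc : ∀ M t l → M * M * (t * l) ≡ M * (t * (M * l))
    assoc = solve-∀
    factor : ∀ M s t → M * M * s + 2 * (t * t * (M * M)) ≡ M * M * (s + 2 * (t * t))
    factor = solve-∀
    p≤P : ∀ {p} → p ∈ ps → p ≤ P
    p≤P p∈ = proj₁ (proj₂ (proj₂ (h p∈)))
    0<p : ∀ {p} → p ∈ ps → 0 < p
    0<p p∈ = ≤-trans (s≤s z≤n) (2≤prime (proj₁ (h p∈)))
    overlaps : ∀ {qs} → Unique qs → (∀ {q} → q ∈ qs → q ∈ ps) →
      AllPairs (λ p q → ∑ pairs (λ e → weight p e * weight q e) ≤ 2 * (M * M)) qs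
    overlaps [] _ = []
    overlaps (q∉qs ∷ u) sub = All.tabulate (λ {r} r∈ → overlapWeight (proj₁ (h (sub (here refl)))) (proj₁ (h (sub (there r∈))))
      (All.lookup q∉qs r∈) (≤-trans (+-mono-≤ (p≤P (sub (here refl))) (p≤P (sub (there r∈)))) 2P≤n)) ∷ overlaps u (sub ∘ there)
    near : ∀ e → 1 ≤ ∑ ps (λ p → weight p e) → Near m (n * P₀) (proj₁ e) (proj₂ e)
    near (y , y′) pos with ∑>0⇒∃ (λ p → weight p (y , y′)) ps pos
    ... | p , p∈ , 1≤w with 𝟙>0 (edge? p y y′) (1≤*⇒1≤ˡ 1≤w)
    ...   | y≢y′ , bin , bin′ , class≡ = y≢y′ , ≤-<-trans
      (≤-trans (≤-reflexive (*-assoc n P₀ _)) (*-monoʳ-≤ n (*-monoˡ-≤ (dist y y′) (proj₁ (proj₂ (h p∈))))))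
      (sameClass⇒near n p class≡ (trans bin (sym bin′)))

-- Averaging over the units

map-unique : {A B : Set} (f : A → B) {xs : List A} → Unique xs →
  (∀ {x y} → x ∈ xs → y ∈ xs → f x ≡ f y → x ≡ y) → Unique (map f xs)
map-unique f [] inj = []
map-unique f {x ∷ xs} (x∉xs ∷ u) inj =
  All.tabulate (λ fy∈ fx≡ → case (∈-map⁻ f fy∈) fx≡) ∷ map-unique f u (λ p q → inj (there p) (there q))
  where
  case : ∀ {z} → ∃[ y ] y ∈ xs × z ≡ f y → f x ≢ z
  case (y , y∈xs , refl) fx≡fy = All.lookup x∉xs y∈xs (inj (here refl) (there y∈xs) fx≡fy)

module _ {m : ℕ} .{{m≢0 : NonZero m}} where

  %≡⇒∣dist : ∀ a b → a % m ≡ b % m → m ∣ dist a b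
  %≡⇒∣dist a b eq = divides (dist (a / m) (b / m)) (begin
    ℤ.∣ + a ℤ.- + b ∣
      ≡⟨ cong ℤ.∣_∣ (cong₂ ℤ._-_ (divMod a) (divMod b)) ⟩
    ℤ.∣ (+ (a % m) ℤ.+ + (a / m) ℤ.* + m) ℤ.- (+ (b % m) ℤ.+ + (b / m) ℤ.* + m) ∣
      ≡⟨ cong (λ r → ℤ.∣ (+ (a % m) ℤ.+ + (a / m) ℤ.* + m) ℤ.- (+ r ℤ.+ + (b / m) ℤ.* + m) ∣) (sym eq) ⟩
    ℤ.∣ (+ (a % m) ℤ.+ + (a / m) ℤ.* + m) ℤ.- (+ (a % m) ℤ.+ + (b / m) ℤ.* + m) ∣
      ≡⟨ cong ℤ.∣_∣ (factor (+ (a % m)) (+ (a / m)) (+ (b / m)) (+ m)) ⟩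
    ℤ.∣ (+ (a / m) ℤ.- + (b / m)) ℤ.* + m ∣
      ≡⟨ ℤ.abs-* (+ (a / m) ℤ.- + (b / m)) (+ m) ⟩
    dist (a / m) (b / m) * m ∎)
    where
    open ≡-Reasoning
    factor : ∀ r k l m → (r ℤ.+ k ℤ.* m) ℤ.- (r ℤ.+ l ℤ.* m) ≡ (k ℤ.- l) ℤ.* m
    factor = ℤSolver.solve-∀

  -- Here m divides r times the distance of a and b, hence the distance itself, which is below m.
  multiplication-injective : ∀ {r a b} → Coprime r m → a < m → b < m → (r * a) % m ≡ (r * b) % m → a ≡ b
  multiplication-injective {r} {a} {b} c a<m b<m eq = dist≡0⇒≡ (∣∧<⇒≡0
    (coprime-divisor (coprime-sym c) (subst (m ∣_) (sym (*-dist r a b)) (%≡⇒∣dist (r * a) (r * b) eq)))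
    (dist< a<m b<m))

  ∈-units⁻ : ∀ {a} → a ∈ units m → a < m × Coprime a m
  ∈-units⁻ a∈ with ∈-filter⁻ (λ k → coprime? k m) {xs = upTo m} a∈
  ... | a∈upTo , c = ∈-upTo⁻ a∈upTo , c

  units-closed : ∀ {r a} → Coprime r m → a ∈ units m → (r * a) % m ∈ units m
  units-closed {r} {a} c a∈ = ∈-filter⁺ (λ k → coprime? k m) (∈-upTo⁺ (m%n<n (r * a) m)) λ {d} (d∣ra% , d∣m) →
    proj₂ (∈-units⁻ a∈) (coprime-factors c (∣n∣m%n⇒∣m d∣m d∣ra% , ∣m⇒∣m*n a d∣m) , d∣m)

  units-unique : Unique (units m)
  units-unique = filter⁺ (λ k → coprime? k m) (upTo⁺ m)

  %-*ʳ : ∀ a b → (a * (b % m)) % m ≡ (a * b) % m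
  %-*ʳ a b = begin
    (a * (b % m)) % m            ≡⟨ %-distribˡ-* a (b % m) m ⟩
    ((a % m) * (b % m % m)) % m  ≡⟨ cong (λ c → ((a % m) * c) % m) (m%n%n≡m%n b m) ⟩
    ((a % m) * (b % m)) % m      ≡⟨ %-distribˡ-* a b m ⟨
    (a * b) % m                  ∎
    where open ≡-Reasoning

  %-*ˡ : ∀ a b → ((a % m) * b) % m ≡ (a * b) % m
  %-*ˡ a b = begin
    ((a % m) * b) % m  ≡⟨ cong (_% m) (*-comm (a % m) b) ⟩
    (b * (a % m)) % m  ≡⟨ %-*ʳ b a ⟩
    (b * a) % m        ≡⟨ cong (_% m) (*-comm b a) ⟩
    (a * b) % m        ∎
    where open ≡-Reasoning

  multiply-assoc : ∀ p b x → ((p * b) % m * x) % m ≡ (p * ((b * x) % m)) % m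
  multiply-assoc p b x = begin
    ((p * b) % m * x) % m    ≡⟨ %-*ˡ (p * b) x ⟩
    (p * b * x) % m          ≡⟨ cong (_% m) (*-assoc p b x) ⟩
    (p * (b * x)) % m        ≡⟨ %-*ʳ p (b * x) ⟨
    (p * ((b * x) % m)) % m  ∎
    where open ≡-Reasoning

  modInverse-mul : ∀ {q r a} → ModInverse m q r → a < m → (q * ((r * a) % m)) % m ≡ a
  modInverse-mul {q} {r} {a} (k , eq) a<m = begin
    (q * ((r * a) % m)) % m  ≡⟨ %-*ʳ q (r * a) ⟩
    (q * (r * a)) % m        ≡⟨ cong (_% m) (trans (sym (*-assoc q r a)) (cong (_* a) eq)) ⟩
    ((1 + k * m) * a) % m    ≡⟨ cong (_% m) (regroup′ k m a) ⟩
    (a + k * a * m) % m      ≡⟨ [m+kn]%n≡m%n a (k * a) m ⟩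
    a % m                    ≡⟨ m<n⇒m%n≡m a<m ⟩
    a                        ∎
    where
    open ≡-Reasoning
    regroup′ : ∀ k m a → (1 + k * m) * a ≡ a + k * a * m
    regroup′ = solve-∀

  -- Substitute b = r a: then q b reduces to a, and a ↦ r a is an injection of the units into
  -- themselves.
  ∑-units-translate : ∀ {q r} → ModInverse m q r → (f : ℕ → ℕ) →
    ∑ (units m) f ≤ ∑ (units m) (λ b → f ((q * b) % m))
  ∑-units-translate {q} {r} inv f = ≤-trans
    (∑-mono (units m) (λ a∈ → ≤-reflexive (cong f (sym (modInverse-mul {q} {r} inv (proj₁ (∈-units⁻ a∈)))))))
    (∑-image (λ a → (r * a) % m) (λ b → f ((q * b) % m)) units-unique (units-closed (modInverse-coprime {m} {q} {r} inv))
      (λ a∈ b∈ → multiplication-injective (modInverse-coprime {m} {q} {r} inv) (proj₁ (∈-units⁻ a∈)) (proj₁ (∈-units⁻ b∈))))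

  modInverse-sym : ∀ {q r} → ModInverse m q r → ModInverse m r q
  modInverse-sym {q} {r} (k , eq) = k , trans (*-comm r q) eq

  -- The value at arguments not coprime to m is junk.
  inverse : ℕ → ℕ
  inverse zero = 0
  inverse q@(suc _) with coprime? q m
  ... | yes c = proj₁ (modInverse c)
  ... | no _ = 0

  inverse-correct : ∀ {q} → Prime q → ¬ q ∣ m → ModInverse m q (inverse q)
  inverse-correct {zero} pq _ = contradiction pq ¬prime[0]
  inverse-correct {q@(suc _)} pq q∤m with coprime? q m
  ... | yes c = proj₂ (modInverse c)
  ... | no ¬c = contradiction (λ {d} → prime∤⇒coprime pq q∤m {d}) ¬c

  nearAt? : (R x x′ b : ℕ) → Dec (Near m R ((b * x) % m) ((b * x′) % m))
  nearAt? R x x′ b = near? m R ((b * x) % m) ((b * x′) % m)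

  module _ {Q R μ : ℕ} {qs : List ℕ} (qs-unique : Unique qs)
    (qs-good : ∀ {q} → q ∈ qs → Prime q × ¬ q ∣ m × q ≤ Q) (2Q≤R : Q + Q ≤ R) (m≤2^μ : m ≤ 2 ^ μ) (x x′ : ℕ) where

    -- Every q for which q⁻¹ b brings x and x′ close divides one and the same positive integer below m.
    quotients-near : ∀ b → ∑ qs (λ q → 𝟙 (nearAt? R x x′ ((inverse q * b) % m))) ≤ μ
    quotients-near b = subst (_≤ μ) (length-filter-∑ good? qs)
      (bound (filter good? qs) (filter⁺ good? qs-unique) (∈-filter⁻ good? {xs = qs}))
      where
      good? : ∀ q → Dec (Near m R (((inverse q * b) % m * x) % m) (((inverse q * b) % m * x′) % m))
      good? q = nearAt? R x x′ ((inverse q * b) % m)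
      gap : ℕ → ℤ
      gap q = + (((inverse q * b) % m * x) % m) ℤ.- + (((inverse q * b) % m * x′) % m)
      bound : ∀ F → Unique F → (∀ {q} → q ∈ F → q ∈ qs × Near m R (((inverse q * b) % m * x) % m) (((inverse q * b) % m * x′) % m)) → length F ≤ μ
      bound [] _ _ = z≤n
      bound F@(q₀ ∷ _) u good = <⇒≤ (2^-cancel-< (≤-<-trans
        (2^length≤ {V} {{>-nonZero 0<V}} u (All.tabulate (isPrime ∘ proj₁ ∘ good)) (All.tabulate q∣V)) (<-≤-trans V<m m≤2^μ)))
        where
        isPrime : ∀ {q} → q ∈ qs → Prime q
        isPrime q∈ = proj₁ (qs-good q∈)
        0<q : ∀ {q} → q ∈ qs → 0 < q
        0<q q∈ = ≤-trans (s≤s z≤n) (2≤prime (isPrime q∈))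
        q₀∈ = proj₁ (good (here refl))
        -- For every q in `F`, the number q times `gap q` is congruent to b (x - x′) modulo m. These
        -- numbers are so small that they coincide, so `V` does not depend on the choice of `q₀`.
        V = q₀ * ℤ.∣ gap q₀ ∣
        small : ∀ {q} → q ∈ F → R * ℤ.∣ gap q ∣ < m
        small q∈ = proj₂ (proj₂ (good q∈))
        q≤R : ∀ {q q′} → q ∈ qs → q′ ∈ qs → q + q′ ≤ R
        q≤R q∈ q′∈ = ≤-trans (+-mono-≤ (proj₂ (proj₂ (qs-good q∈))) (proj₂ (proj₂ (qs-good q′∈)))) 2Q≤R
        -- Nearness includes distinctness, so the gap is nonzero; zero would be divisible by every
        -- prime.
        0<V : 0 < V
        0<V = *-mono-≤ (0<q q₀∈) (n≢0⇒n>0 (proj₁ (proj₂ (good (here refl))) ∘ dist≡0⇒≡))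
        V<m : V < m
        V<m = ≤-<-trans (*-monoˡ-≤ ℤ.∣ gap q₀ ∣ (≤-trans (m≤m+n q₀ q₀) (q≤R q₀∈ q₀∈))) (small (here refl))
        q∣V : ∀ {q} → q ∈ F → q ∣ V
        q∣V {q} q∈ = divides ℤ.∣ gap q ∣ (begin
          q₀ * ℤ.∣ gap q₀ ∣      ≡⟨ ℤ.abs-* (+ q₀) (gap q₀) ⟨
          ℤ.∣ + q₀ ℤ.* gap q₀ ∣  ≡⟨ cong ℤ.∣_∣ (congruent-multiples {q = q₀} {q} {R} {gap q₀} {gap q}
                                      {e = (proj₁ (red q₀∈ x) ℤ.- proj₁ (red q₀∈ x′)) ℤ.- (proj₁ (red q∈qs x) ℤ.- proj₁ (red q∈qs x′))}
                                      (0<q q₀∈) (q≤R q₀∈ q∈qs) (small (here refl)) (small q∈) congruence) ⟩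
          ℤ.∣ + q ℤ.* gap q ∣    ≡⟨ ℤ.abs-* (+ q) (gap q) ⟩
          q * ℤ.∣ gap q ∣        ≡⟨ *-comm q _ ⟩
          ℤ.∣ gap q ∣ * q        ∎)
          where
          open ≡-Reasoning
          q∈qs = proj₁ (good q∈)
          red : ∀ {q} → q ∈ qs → ∀ x → ∃[ e ] + (q * (((inverse q * b) % m * x) % m)) ≡ + (b * x) ℤ.+ e ℤ.* + m
          red {q} q∈ x = modInverse-cancel {q = q} {r = inverse q} (inverse-correct (isPrime q∈) (proj₁ (proj₂ (qs-good q∈)))) b x
          expand : ∀ q z z′ → + q ℤ.* (+ z ℤ.- + z′) ≡ + (q * z) ℤ.- + (q * z′)
          expand q z z′ = trans (distribSub′ (+ q) (+ z) (+ z′)) (cong₂ ℤ._-_ (sym (ℤ.pos-* q z)) (sym (ℤ.pos-* q z′)))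
            where
            distribSub′ : ∀ k a b → k ℤ.* (a ℤ.- b) ≡ k ℤ.* a ℤ.- k ℤ.* b
            distribSub′ = ℤSolver.solve-∀
          side : ∀ {q} (q∈ : q ∈ qs) → + q ℤ.* gap q ≡
            (+ (b * x) ℤ.+ proj₁ (red q∈ x) ℤ.* + m) ℤ.- (+ (b * x′) ℤ.+ proj₁ (red q∈ x′) ℤ.* + m)
          side {q} q∈ = trans (expand q (((inverse q * b) % m * x) % m) (((inverse q * b) % m * x′) % m))
            (cong₂ ℤ._-_ (proj₂ (red q∈ x)) (proj₂ (red q∈ x′)))
          combine : ∀ y y′ e e′ f f′ m → ((y ℤ.+ e ℤ.* m) ℤ.- (y′ ℤ.+ e′ ℤ.* m)) ℤ.- ((y ℤ.+ f ℤ.* m) ℤ.- (y′ ℤ.+ f′ ℤ.* m))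
            ≡ ((e ℤ.- e′) ℤ.- (f ℤ.- f′)) ℤ.* m
          combine = ℤSolver.solve-∀
          congruence : + q₀ ℤ.* gap q₀ ℤ.- + q ℤ.* gap q ≡
            ((proj₁ (red q₀∈ x) ℤ.- proj₁ (red q₀∈ x′)) ℤ.- (proj₁ (red q∈qs x) ℤ.- proj₁ (red q∈qs x′))) ℤ.* + m
          congruence = trans (cong₂ ℤ._-_ (side q₀∈) (side q∈qs))
            (combine (+ (b * x)) (+ (b * x′)) (proj₁ (red q₀∈ x)) (proj₁ (red q₀∈ x′)) (proj₁ (red q∈qs x)) (proj₁ (red q∈qs x′)) (+ m))

    -- For each q the substitution of q⁻¹ b for b leaves the sum over the units no smaller. After
    -- exchanging the sums, a fixed b is hit by at most μ primes.
    near-count : length qs * ∑ (units m) (λ b → 𝟙 (nearAt? R x x′ b)) ≤ length (units m) * μ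
    near-count = begin
      length qs * ∑ (units m) (λ b → 𝟙 (nearAt? R x x′ b))
        ≡⟨ ∑-const _ qs ⟨
      ∑ qs (λ _ → ∑ (units m) (λ b → 𝟙 (nearAt? R x x′ b)))
        ≤⟨ ∑-mono qs (λ {q} q∈ → ∑-units-translate {inverse q} {q} (modInverse-sym {q} {inverse q} (inverse-correct (proj₁ (qs-good q∈)) (proj₁ (proj₂ (qs-good q∈))))) (λ b → 𝟙 (nearAt? R x x′ b))) ⟩
      ∑ qs (λ q → ∑ (units m) (λ b → 𝟙 (nearAt? R x x′ ((inverse q * b) % m))))
        ≡⟨ ∑-swap qs (units m) _ ⟩
      ∑ (units m) (λ b → ∑ qs (λ q → 𝟙 (nearAt? R x x′ ((inverse q * b) % m))))
        ≤⟨ ∑-≤-const (units m) (λ {b} _ → quotients-near b) ⟩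
      length (units m) * μ ∎
      where open ≤-Reasoning

-- The overlaps cost 2 t² ≤ 4 t P and the isolated points t P. Together this is at most 5/16 of t L,
-- so more than half of t L survives.
absorb-square : ∀ {t P L N} → t ≤ 2 * P → 16 * P ≤ L → t * (L ∸ P) ≤ N + 2 * (t * t) → t * L ≤ 2 * N
absorb-square {t} {P} {L} {N} t≤2P 16P≤L h = +-cancelʳ-≤ (t * L) _ _ (begin
  t * L + t * L                         ≡⟨ double (t * L) ⟩
  2 * (t * L)                           ≤⟨ *-monoʳ-≤ 2 tL≤ ⟩
  2 * (N + 5 * (t * P))                 ≡⟨ expand N (t * P) ⟩
  2 * N + 10 * (t * P)                  ≤⟨ +-monoʳ-≤ (2 * N) (*-monoˡ-≤ (t * P) (m≤m+n 10 6)) ⟩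
  2 * N + 16 * (t * P)                  ≡⟨ cong (λ t → 2 * N + t) (commute t P) ⟩
  2 * N + t * (16 * P)                  ≤⟨ +-monoʳ-≤ (2 * N) (*-monoʳ-≤ t 16P≤L) ⟩
  2 * N + t * L                         ∎)
  where
  open ≤-Reasoning
  double : ∀ a → a + a ≡ 2 * a
  double = solve-∀
  expand : ∀ a b → 2 * (a + 5 * b) ≡ 2 * a + 10 * b
  expand = solve-∀
  commute : ∀ t P → 16 * (t * P) ≡ t * (16 * P)
  commute = solve-∀
  collect : ∀ N t P → N + 2 * (t * (2 * P)) + t * P ≡ N + 5 * (t * P)
  collect = solve-∀
  tL≤ : t * L ≤ N + 5 * (t * P)
  tL≤ = begin
    t * L                               ≤⟨ *-monoʳ-≤ t (m≤n+m∸n L P) ⟩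
    t * (P + (L ∸ P))                   ≡⟨ trans (*-distribˡ-+ t P (L ∸ P)) (+-comm (t * P) _) ⟩
    t * (L ∸ P) + t * P                 ≤⟨ +-monoˡ-≤ (t * P) (≤-trans h (+-monoʳ-≤ N (*-monoʳ-≤ 2 (*-monoʳ-≤ t t≤2P)))) ⟩
    N + 2 * (t * (2 * P)) + t * P       ≡⟨ collect N t P ⟩
    N + 5 * (t * P)                     ∎

-- Counting the rich units

module Loads {m n : ℕ} .{{m≢0 : NonZero m}} (es : List ℕ) (es-unique : Unique es)
  (es<m : ∀ {x} → x ∈ es → x < m) (length-es : length es ≡ n) (peakLoad : ℕ → ℕ)
  (peak : ∀ a → ∃[ β ] peakLoad a ≤ ∑ es (λ x → 𝟙 ((n * ((a * x) % m)) / m ≟ β))) where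

  richCount : ℕ → ℕ
  richCount L = ∑ (units m) (λ a → 𝟙 (L ≤? peakLoad a))

  peakLoad≤n : ∀ a → peakLoad a ≤ n
  peakLoad≤n a with peak a
  ... | β , h = ≤-trans h (≤-trans (∑-≤-const es (λ {x} _ → 𝟙≤1 ((n * ((a * x) % m)) / m ≟ β)))
                            (≤-reflexive (trans (*-identityʳ _) length-es)))

  richCount≤ : ∀ L → richCount L ≤ length (units m)
  richCount≤ L = ≤-trans (∑-≤-const (units m) (λ {a} _ → 𝟙≤1 (L ≤? peakLoad a))) (≤-reflexive (*-identityʳ _))

  richCount-large : ∀ {L} → n < L → richCount L ≡ 0
  richCount-large {L} n<L = trans (∑-cong (λ a → 𝟙-no (L ≤? peakLoad a) (λ L≤ → <⇒≱ n<L (≤-trans L≤ (peakLoad≤n a)))) (units m)) (∑-zero (units m))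

  module _ {P P₀ L Q μ : ℕ} {ps qs : List ℕ} (ps-unique : Unique ps) (qs-unique : Unique qs)
    (ps-good : ∀ {p} → p ∈ ps → Prime p × ¬ p ∣ m × P₀ ≤ p × p ≤ P)
    (qs-good : ∀ {q} → q ∈ qs → Prime q × ¬ q ∣ m × q ≤ Q)
    (length-ps : length ps ≤ 2 * P) (2P≤n : P + P ≤ n) (16P≤L : 16 * P ≤ L)
    (2Q≤nP₀ : Q + Q ≤ n * P₀) (m≤2^μ : m ≤ 2 ^ μ) where

    nearCount : ℕ → ℕ
    nearCount b = ∑ es (λ x → ∑ es (λ x′ → 𝟙 (nearAt? (n * P₀) x x′ b)))

    rich? : ∀ b p → Dec (L ≤ peakLoad ((p * b) % m))
    rich? b p = L ≤? peakLoad ((p * b) % m)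

    -- The points are replaced by their images under b; by `multiply-assoc`, the bin of x under p b
    -- is the bin of its image under p, so `nearPairs-lower` applies to all rich p at once.
    richPrimes-bound : ∀ {b} → b ∈ units m → ∑ ps (λ p → 𝟙 (rich? b p)) * L ≤ 2 * nearCount b
    richPrimes-bound {b} b∈ = subst₂ (λ t N → t * L ≤ 2 * N) (length-filter-∑ (rich? b) ps) nearPairs≡
      (absorb-square {P = P} {N = nearPairs m (n * P₀) ys} (≤-trans (length-filter (rich? b) ps) length-ps) 16P≤L
        (nearPairs-lower (filter⁺ (rich? b) ps-unique) 2P≤n good))
      where
      image : ℕ → ℕ
      image x = (b * x) % m
      ys = map image es
      β : ℕ → ℕ
      β p = proj₁ (peak ((p * b) % m))
      ys-unique : Unique ys
      ys-unique = map-unique image es-unique λ x∈ x′∈ →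
        multiplication-injective (proj₂ (∈-units⁻ b∈)) (es<m x∈) (es<m x′∈)
      ys<m : ∀ {y} → y ∈ ys → y < m
      ys<m y∈ with ∈-map⁻ image y∈
      ... | x , _ , refl = m%n<n (b * x) m
      open RichMultipliers n β ys-unique ys<m
      nearPairs≡ : nearPairs m (n * P₀) ys ≡ nearCount b
      nearPairs≡ = trans (∑-map _ image es) (∑-cong (λ x → ∑-map _ image es) es)
      good : ∀ {p} → p ∈ filter (rich? b) ps → Prime p × P₀ ≤ p × p ≤ P × L ≤ ∑ ys (λ y → 𝟙 (inBin? p y))
      good {p} p∈ with ∈-filter⁻ (rich? b) {xs = ps} p∈
      ... | p∈ps , rich with ps-good p∈ps
      ...   | pp , _ , P₀≤p , p≤P = pp , P₀≤p , p≤P , (begin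
        L                                                              ≤⟨ rich ⟩
        peakLoad ((p * b) % m)                                         ≤⟨ proj₂ (peak ((p * b) % m)) ⟩
        ∑ es (λ x → 𝟙 ((n * (((p * b) % m * x) % m)) / m ≟ β p))       ≡⟨ ∑-cong (λ x → cong (λ r → 𝟙 ((n * r) / m ≟ β p)) (multiply-assoc p b x)) es ⟩
        ∑ es (λ x → 𝟙 (inBin? p (image x)))                            ≡⟨ ∑-map _ image es ⟨
        ∑ ys (λ y → 𝟙 (inBin? p y))                                    ∎)
        where open ≤-Reasoning

    -- Double counting of triples (b, x, x′). Translating by each p turns rich units into rich
    -- multiples p b, and `richPrimes-bound` turns those into near pairs; `near-count` bounds the
    -- units for which a fixed pair is near.
    richCount-bound : richCount L * length ps * length qs * L ≤ 2 * (n * n * (length (units m) * μ))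
    richCount-bound = begin
      richCount L * length ps * length qs * L
        ≡⟨ permute (richCount L) (length ps) (length qs) L ⟩
      length qs * (length ps * richCount L * L)
        ≤⟨ *-monoʳ-≤ (length qs) (begin
             length ps * richCount L * L
               ≡⟨ cong (_* L) (∑-const (richCount L) ps) ⟨
             ∑ ps (λ _ → richCount L) * L
               ≤⟨ *-monoˡ-≤ L (∑-mono ps (λ {p} p∈ → ∑-units-translate {q = p} {r = inverse p}
                    (inverse-correct (proj₁ (ps-good p∈)) (proj₁ (proj₂ (ps-good p∈)))) (λ a → 𝟙 (L ≤? peakLoad a)))) ⟩
             ∑ ps (λ p → ∑ (units m) (λ b → 𝟙 (rich? b p))) * L
               ≡⟨ cong (_* L) (∑-swap ps (units m) (λ p b → 𝟙 (rich? b p))) ⟩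
             ∑ (units m) (λ b → ∑ ps (λ p → 𝟙 (rich? b p))) * L
               ≡⟨ ∑-*ʳ L _ (units m) ⟨
             ∑ (units m) (λ b → ∑ ps (λ p → 𝟙 (rich? b p)) * L)
               ≤⟨ ∑-mono (units m) richPrimes-bound ⟩
             ∑ (units m) (λ b → 2 * nearCount b)
               ≡⟨ ∑-*ˡ 2 nearCount (units m) ⟩
             2 * ∑ (units m) nearCount ∎) ⟩
      length qs * (2 * ∑ (units m) nearCount)
        ≡⟨ swap (length qs) (∑ (units m) nearCount) ⟩
      2 * (length qs * ∑ (units m) nearCount)
        ≤⟨ *-monoʳ-≤ 2 (begin
             length qs * ∑ (units m) nearCount
               ≡⟨ cong (length qs *_) (trans (∑-swap (units m) es _) (∑-cong (λ x → ∑-swap (units m) es _) es)) ⟩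
             length qs * ∑ es (λ x → ∑ es (λ x′ → ∑ (units m) (λ b → 𝟙 (near x x′ b))))
               ≡⟨ trans (sym (∑-*ˡ (length qs) _ es)) (∑-cong (λ x → sym (∑-*ˡ (length qs) _ es)) es) ⟩
             ∑ es (λ x → ∑ es (λ x′ → length qs * ∑ (units m) (λ b → 𝟙 (near x x′ b))))
               ≤⟨ ∑-≤-const es (λ {x} _ → ∑-≤-const es (λ {x′} _ → near-count {μ = μ} qs-unique qs-good 2Q≤nP₀ m≤2^μ x x′)) ⟩
             length es * (length es * (length (units m) * μ))
               ≡⟨ trans (cong (λ k → k * (k * (length (units m) * μ))) length-es) (sym (*-assoc n n _)) ⟩
             n * n * (length (units m) * μ) ∎) ⟩
      2 * (n * n * (length (units m) * μ)) ∎
      where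
      open ≤-Reasoning
      near = nearAt? (n * P₀)
      permute : ∀ r p q L → r * p * q * L ≡ q * (p * r * L)
      permute = solve-∀
      swap : ∀ q s → q * (2 * s) ≡ 2 * (q * s)
      swap = solve-∀

-- The tail of the maximum load

cube : ℕ → ℕ
cube a = a * a * a

m<d*[1+m/d] : ∀ a d .{{_ : NonZero d}} → a < d * suc (a / d)
m<d*[1+m/d] a d = begin-strict
  a                       ≡⟨ m≡m%n+[m/n]*n a d ⟩
  a % d + a / d * d       <⟨ +-monoˡ-< (a / d * d) (m%n<n a d) ⟩
  d + a / d * d           ≡⟨ *-comm (suc (a / d)) d ⟩
  d * suc (a / d)         ∎
  where open ≤-Reasoning

d*[m/d]≤m : ∀ a d .{{_ : NonZero d}} → d * (a / d) ≤ a
d*[m/d]≤m a d = ≤-trans (≤-reflexive (*-comm d (a / d))) (m/n*n≤m a d)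

suc≤2* : ∀ {a} → 1 ≤ a → suc a ≤ 2 * a
suc≤2* {a} 1≤a = ≤-trans (+-monoˡ-≤ a 1≤a) (≤-reflexive (cong (λ t → a + t) (sym (+-identityʳ a))))

length-primesUpTo : ∀ {Q} → 1 ≤ Q → length (primesUpTo Q) ≤ 2 * Q
length-primesUpTo {Q} 1≤Q = ≤-trans (length-filter prime? (upTo (suc Q)))
  (≤-trans (≤-reflexive (length-upTo (suc Q))) (suc≤2* 1≤Q))

admissible? : ∀ m P₀ p → Dec (¬ p ∣ m × P₀ ≤ p)
admissible? m P₀ p = ¬? (p ∣? m) ×-dec (P₀ ≤? p)

admissiblePrimes : (m P₀ P : ℕ) → List ℕ
admissiblePrimes m P₀ P = filter (admissible? m P₀) (primesUpTo P)

admissiblePrimes-unique : ∀ m P₀ P → Unique (admissiblePrimes m P₀ P)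
admissiblePrimes-unique m P₀ P = filter⁺ (admissible? m P₀) (primesUpTo-unique P)

∈-admissiblePrimes : ∀ {m P₀ P p} → p ∈ admissiblePrimes m P₀ P → Prime p × ¬ p ∣ m × P₀ ≤ p × p ≤ P
∈-admissiblePrimes {m} {P₀} {P} p∈ with ∈-filter⁻ (admissible? m P₀) {xs = primesUpTo P} p∈
... | p∈primes , p∤m , P₀≤p = proj₁ (∈-primesUpTo⁻ {Q = P} p∈primes) , p∤m , P₀≤p , proj₂ (∈-primesUpTo⁻ {Q = P} p∈primes)

-- The rejected primes either divide m, and there are at most μ of those, or lie below `P₀`.
admissiblePrimes-count : ∀ {m μ P₀ P} .{{_ : NonZero m}} → m ≤ 2 ^ μ →
  length (primesUpTo P) ≤ length (admissiblePrimes m P₀ P) + (μ + P₀)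
admissiblePrimes-count {m} {μ} {P₀} {P} m≤2^μ = begin
  length ps
    ≡⟨ trans (sym (*-identityʳ _)) (sym (∑-const 1 ps)) ⟩
  ∑ ps (λ _ → 1)
    ≤⟨ ∑-mono ps (λ {p} _ → cover p) ⟩
  ∑ ps (λ p → 𝟙 (admissible? m P₀ p) + (𝟙 (p ∣? m) + 𝟙 (p <? P₀)))
    ≡⟨ trans (∑-+ _ _ ps) (cong (λ t → ∑ ps (λ p → 𝟙 (admissible? m P₀ p)) + t) (∑-+ _ _ ps)) ⟩
  ∑ ps (λ p → 𝟙 (admissible? m P₀ p)) + (∑ ps (λ p → 𝟙 (p ∣? m)) + ∑ ps (λ p → 𝟙 (p <? P₀)))
    ≡⟨ cong₂ _+_ (length-filter-∑ (admissible? m P₀) ps) (cong₂ _+_ (length-filter-∑ (_∣? m) ps) (length-filter-∑ (_<? P₀) ps)) ⟨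
  length (admissiblePrimes m P₀ P) + (length (filter (_∣? m) ps) + length (filter (_<? P₀) ps))
    ≤⟨ +-monoʳ-≤ (length (admissiblePrimes m P₀ P)) (+-mono-≤ divisors small) ⟩
  length (admissiblePrimes m P₀ P) + (μ + P₀) ∎
  where
  open ≤-Reasoning
  ps = primesUpTo P
  u = primesUpTo-unique P
  cover : ∀ p → 1 ≤ 𝟙 (admissible? m P₀ p) + (𝟙 (p ∣? m) + 𝟙 (p <? P₀))
  cover p = cases (p ∣? m) (P₀ ≤? p)
    where
    cases : Dec (p ∣ m) → Dec (P₀ ≤ p) → 1 ≤ 𝟙 (admissible? m P₀ p) + (𝟙 (p ∣? m) + 𝟙 (p <? P₀))
    cases (yes p∣m) _ = m≤n⇒m≤o+n (𝟙 (admissible? m P₀ p)) (≤-trans (≤-reflexive (sym (𝟙-yes (p ∣? m) p∣m))) (m≤m+n _ _))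
    cases (no p∤m) (yes P₀≤p) = ≤-trans (≤-reflexive (sym (𝟙-yes (admissible? m P₀ p) (p∤m , P₀≤p)))) (m≤m+n _ _)
    cases (no _) (no P₀≰p) = m≤n⇒m≤o+n (𝟙 (admissible? m P₀ p)) (m≤n⇒m≤o+n (𝟙 (p ∣? m)) (≤-reflexive (sym (𝟙-yes (p <? P₀) (≰⇒> P₀≰p)))))
  divisors : length (filter (_∣? m) ps) ≤ μ
  divisors = 2^-cancel-≤ (≤-trans
    (2^length≤ (filter⁺ (_∣? m) u)
      (All.tabulate λ p∈ → proj₁ (∈-primesUpTo⁻ {Q = P} (proj₁ (∈-filter⁻ (_∣? m) {xs = ps} p∈))))
      (All.tabulate λ p∈ → proj₂ (∈-filter⁻ (_∣? m) {xs = ps} p∈))) m≤2^μ)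
  small : length (filter (_<? P₀) ps) ≤ P₀
  small = subst (length (filter (_<? P₀) ps) ≤_) (length-upTo P₀) (length-image id (filter⁺ (_<? P₀) u)
    (λ p∈ → ∈-upTo⁺ (proj₂ (∈-filter⁻ (_<? P₀) {xs = ps} p∈))) (λ _ _ → id))

-- In `primeCount-lower` the rejected primes cost 1 + h² μ and h² P₀. Each is at most P / 4 by
-- hypothesis, so half of P remains.
admissiblePrimes-lower : ∀ {m μ P₀ P h} .{{_ : NonZero m}} → m ≤ 2 ^ μ → P < 2 ^ h →
  4 * (h * h) * P₀ ≤ P → 4 * (h * h) * μ + 4 ≤ P → P ≤ 2 * (h * h) * length (admissiblePrimes m P₀ P)
admissiblePrimes-lower {m} {μ} {P₀} {P} {h} m≤2^μ P<2^h P₀-small P-large =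
  *-cancelˡ-≤ 2 (+-cancelʳ-≤ (2 * P) _ _ (begin
    2 * P + 2 * P                              ≡⟨ double P ⟩
    4 * P                                      ≤⟨ *-monoʳ-≤ 4 (≤-trans (primeCount-lower {h = h} P<2^h) (+-monoʳ-≤ 1 (*-monoʳ-≤ H (admissiblePrimes-count {P₀ = P₀} {P} m≤2^μ)))) ⟩
    4 * (1 + H * (A + (μ + P₀)))               ≡⟨ expand H A μ P₀ ⟩
    2 * (2 * H * A) + ((4 * H * μ + 4) + 4 * H * P₀) ≤⟨ +-monoʳ-≤ (2 * (2 * H * A)) (+-mono-≤ P-large P₀-small) ⟩
    2 * (2 * H * A) + (P + P)                  ≡⟨ cong (λ t → 2 * (2 * H * A) + t) (cong (λ t → P + t) (sym (+-identityʳ P))) ⟩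
    2 * (2 * H * A) + 2 * P                    ∎))
  where
  open ≤-Reasoning
  H = h * h
  A = length (admissiblePrimes m P₀ P)
  double : ∀ P → 2 * P + 2 * P ≡ 4 * P
  double = solve-∀
  expand : ∀ H A μ P₀ → 4 * (1 + H * (A + (μ + P₀))) ≡ 2 * (2 * H * A) + ((4 * H * μ + 4) + 4 * H * P₀)
  expand = solve-∀

-- Write n r L³ as (r L) · L · (n L), replace the last two factors by the prime counts a and b, and
-- cancel one n.
cube-bound : ∀ {r a b n L φ μ α γ} .{{_ : NonZero n}} → r * a * b * L ≤ 2 * (n * n * (φ * μ)) →
  L ≤ α * a → n * L ≤ γ * b → r * cube L ≤ φ * (n * (2 * α * γ * μ))
cube-bound {r} {a} {b} {n} {L} {φ} {μ} {α} {γ} h L≤ nL≤ = *-cancelˡ-≤ n (begin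
  n * (r * cube L)              ≡⟨ reorder n r L ⟩
  r * L * (L * (n * L))              ≤⟨ *-monoʳ-≤ (r * L) (*-mono-≤ L≤ nL≤) ⟩
  r * L * (α * a * (γ * b))          ≡⟨ gather r L α a γ b ⟩
  α * γ * (r * a * b * L)            ≤⟨ *-monoʳ-≤ (α * γ) h ⟩
  α * γ * (2 * (n * n * (φ * μ)))    ≡⟨ finish α γ n φ μ ⟩
  n * (φ * (n * (2 * α * γ * μ)))    ∎)
  where
  open ≤-Reasoning
  reorder : ∀ n r L → n * (r * (L * L * L)) ≡ r * L * (L * (n * L))
  reorder = solve-∀
  gather : ∀ r L α a γ b → r * L * (α * a * (γ * b)) ≡ α * γ * (r * a * b * L)
  gather = solve-∀
  finish : ∀ α γ n φ μ → α * γ * (2 * (n * n * (φ * μ))) ≡ n * (φ * (n * (2 * α * γ * μ)))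
  finish = solve-∀

cube-mono : ∀ {a b} → a ≤ b → cube a ≤ cube b
cube-mono a≤b = *-mono-≤ (*-mono-≤ a≤b a≤b) a≤b

-- The size required of `P` in `admissiblePrimes-lower`.
threshold : ℕ → ℕ → ℕ
threshold h μ = 4 * (h * h) * μ + 4

-- The first summand is 2 α γ μ from `cube-bound`, for large L; the second covers the L too small
-- for the prime count.
tailConstant : ℕ → ℕ → ℕ
tailConstant h μ = 2 * (64 * H) * (2048 * (H * H)) * μ + cube T
  where
  H = h * h
  T = 32 * threshold h μ

module _ {m n : ℕ} .{{m≢0 : NonZero m}} .{{n≢0 : NonZero n}} (es : List ℕ) (es-unique : Unique es)
  (es<m : ∀ {x} → x ∈ es → x < m) (length-es : length es ≡ n) (peakLoad : ℕ → ℕ)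
  (peak : ∀ a → ∃[ β ] peakLoad a ≤ ∑ es (λ x → 𝟙 ((n * ((a * x) % m)) / m ≟ β))) where

  open Loads es es-unique es<m length-es peakLoad peak

  -- Three ranges: no load exceeds n; for small L the cube of L is below the constant and the
  -- trivial bound on `richCount` suffices; in between, primes of suitable sizes are fed into
  -- `richCount-bound`.
  richCount-tail : ∀ {λ′ μ} → 1 ≤ λ′ → 1 ≤ μ → n < 2 ^ λ′ → m ≤ 2 ^ μ → ∀ L →
    richCount L * cube L ≤ length (units m) * (n * tailConstant (2 * λ′) μ)
  richCount-tail {λ′} {μ} 1≤λ 1≤μ n<2^λ m≤2^μ L with L ≤? n
  ... | no L≰n = ≤-trans (≤-reflexive (cong (_* cube L) (richCount-large (≰⇒> L≰n)))) z≤n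
  ... | yes L≤n with threshold (2 * λ′) μ ≤? L / 16
  ...   | no small = *-mono-≤ (richCount≤ L) (begin
    cube L                ≤⟨ cube-mono L≤ ⟩
    cube T                ≤⟨ m≤n+m (cube T) (2 * (64 * (h * h)) * (2048 * ((h * h) * (h * h))) * μ) ⟩
    tailConstant h μ         ≤⟨ m≤n*m (tailConstant h μ) n ⟩
    n * tailConstant h μ     ∎)
    where
    open ≤-Reasoning
    h = 2 * λ′
    T = 32 * threshold h μ
    L≤ : L ≤ T
    L≤ = begin
      L                      ≤⟨ <⇒≤ (m<d*[1+m/d] L 16) ⟩
      16 * suc (L / 16)      ≤⟨ *-monoʳ-≤ 16 (≰⇒> small) ⟩
      16 * threshold h μ     ≤⟨ *-monoˡ-≤ (threshold h μ) (m≤m+n 16 16) ⟩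
      T                      ∎
  ...   | yes large = ≤-trans (cube-bound {r = richCount L} {a = length ps} {b = length qs} {φ = length (units m)} {μ = μ} {α = 64 * H} {γ = 2048 * (H * H)} main L≤ nL≤)
    (*-monoʳ-≤ (length (units m)) (*-monoʳ-≤ n (m≤m+n (2 * (64 * H) * (2048 * (H * H)) * μ) (cube T))))
    where
    open ≤-Reasoning
    -- Doubled because `Q` can be of order n², and `2 ^ h` has to exceed both `P` and `Q`.
    h = 2 * λ′
    H = h * h
    1≤H : 1 ≤ H
    1≤H = *-mono-≤ 1≤h 1≤h
      where
      1≤h : 1 ≤ h
      1≤h = *-mono-≤ (s≤s (z≤n {1})) 1≤λ
    instance
      4H≢0 : NonZero (4 * H)
      4H≢0 = >-nonZero (*-mono-≤ (s≤s (z≤n {3})) 1≤H)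
    -- The divisor 16 is the one of `absorb-square`, the divisor `4 * H` is dictated by
    -- `admissiblePrimes-lower`, and `Q` is the largest value with 2 Q ≤ n P₀.
    P = L / 16
    P₀ = P / (4 * H)
    Q = (n * P₀) / 2
    ps = admissiblePrimes m P₀ P
    qs = admissiblePrimes m 0 Q
    1≤threshold : 1 ≤ threshold h μ
    1≤threshold = ≤-trans (s≤s (z≤n {3})) (m≤n+m 4 _)
    T = 32 * threshold h μ
    4H≤P : 4 * H ≤ P
    4H≤P = begin
      4 * H                ≡⟨ *-identityʳ (4 * H) ⟨
      4 * H * 1            ≤⟨ *-monoʳ-≤ (4 * H) 1≤μ ⟩
      4 * H * μ            ≤⟨ m≤m+n _ 4 ⟩
      threshold h μ        ≤⟨ large ⟩
      P                    ∎
    1≤P : 1 ≤ P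
    1≤P = ≤-trans 1≤threshold large
    1≤P₀ : 1 ≤ P₀
    1≤P₀ = m≥n⇒m/n>0 4H≤P
    16P≤L : 16 * P ≤ L
    16P≤L = d*[m/d]≤m L 16
    P≤n : P ≤ n
    P≤n = ≤-trans (m/n≤m L 16) L≤n
    2P≤n : P + P ≤ n
    2P≤n = begin
      P + P                ≤⟨ m≤m+n (P + P) (14 * P) ⟩
      P + P + 14 * P       ≡⟨ sixteen P ⟩
      16 * P               ≤⟨ 16P≤L ⟩
      L                    ≤⟨ L≤n ⟩
      n                    ∎
      where
      sixteen : ∀ P → P + P + 14 * P ≡ 16 * P
      sixteen = solve-∀
    2Q≤nP₀ : Q + Q ≤ n * P₀
    2Q≤nP₀ = ≤-trans (≤-reflexive (cong (λ t → Q + t) (sym (+-identityʳ Q)))) (d*[m/d]≤m (n * P₀) 2)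
    threshold≤Q : threshold h μ ≤ Q
    threshold≤Q = s≤s⁻¹ (*-cancelˡ-< 2 _ _ (begin-strict
      2 * threshold h μ    ≤⟨ *-monoˡ-≤ (threshold h μ) (m≤m+n 2 14) ⟩
      16 * threshold h μ   ≤⟨ ≤-trans (*-monoʳ-≤ 16 large) (≤-trans 16P≤L L≤n) ⟩
      n                    ≤⟨ m≤m*n n P₀ {{>-nonZero 1≤P₀}} ⟩
      n * P₀               <⟨ m<d*[1+m/d] (n * P₀) 2 ⟩
      2 * suc Q            ∎))
    n²<2^h : n * n < 2 ^ h
    n²<2^h = begin-strict
      n * n                <⟨ *-mono-< n<2^λ n<2^λ ⟩
      2 ^ λ′ * 2 ^ λ′      ≡⟨ ^-distribˡ-+-* 2 λ′ λ′ ⟨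
      2 ^ (λ′ + λ′)        ≡⟨ cong (λ e → 2 ^ (λ′ + e)) (+-identityʳ λ′) ⟨
      2 ^ h                ∎
    P<2^h : P < 2 ^ h
    P<2^h = ≤-<-trans (≤-trans P≤n (m≤m*n n n)) n²<2^h
    Q<2^h : Q < 2 ^ h
    Q<2^h = ≤-<-trans (≤-trans (m/n≤m (n * P₀) 2) (*-monoʳ-≤ n (≤-trans (m/n≤m P (4 * H)) P≤n))) n²<2^h
    P≤ : P ≤ 2 * H * length ps
    P≤ = admissiblePrimes-lower {h = h} m≤2^μ P<2^h (d*[m/d]≤m P (4 * H)) large
    Q≤ : Q ≤ 2 * H * length qs
    Q≤ = admissiblePrimes-lower {P₀ = 0} {h = h} m≤2^μ Q<2^h (≤-trans (≤-reflexive (*-zeroʳ (4 * H))) z≤n) threshold≤Q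
    L≤32P : L ≤ 32 * P
    L≤32P = begin
      L                    ≤⟨ <⇒≤ (m<d*[1+m/d] L 16) ⟩
      16 * suc P           ≤⟨ *-monoʳ-≤ 16 (suc≤2* 1≤P) ⟩
      16 * (2 * P)         ≡⟨ *-assoc 16 2 P ⟨
      32 * P               ∎
    L≤ : L ≤ 64 * H * length ps
    L≤ = begin
      L                            ≤⟨ ≤-trans L≤32P (*-monoʳ-≤ 32 P≤) ⟩
      32 * (2 * H * length ps)     ≡⟨ regroup₁ H (length ps) ⟩
      64 * H * length ps           ∎
      where
      regroup₁ : ∀ H a → 32 * (2 * H * a) ≡ 64 * H * a
      regroup₁ = solve-∀
    -- The constant collects L ≤ 32 P, P ≤ 4 H · 2 P₀, n P₀ ≤ 4 Q and Q ≤ 2 H times the number of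
    -- primes; each rounding in a division costs a factor 2.
    nL≤ : n * L ≤ 2048 * (H * H) * length qs
    nL≤ = begin
      n * L                        ≤⟨ *-monoʳ-≤ n (≤-trans L≤32P (*-monoʳ-≤ 32 (≤-trans (<⇒≤ (m<d*[1+m/d] P (4 * H))) (*-monoʳ-≤ (4 * H) (suc≤2* 1≤P₀))))) ⟩
      n * (32 * (4 * H * (2 * P₀)))  ≡⟨ regroup₁ n H P₀ ⟩
      256 * H * (n * P₀)           ≤⟨ *-monoʳ-≤ (256 * H) (≤-trans (<⇒≤ (m<d*[1+m/d] (n * P₀) 2)) (*-monoʳ-≤ 2 (suc≤2* (≤-trans 1≤threshold threshold≤Q)))) ⟩
      256 * H * (2 * (2 * Q))      ≤⟨ *-monoʳ-≤ (256 * H) (*-monoʳ-≤ 2 (*-monoʳ-≤ 2 Q≤)) ⟩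
      256 * H * (2 * (2 * (2 * H * length qs)))  ≡⟨ regroup₂ H (length qs) ⟩
      2048 * (H * H) * length qs   ∎
      where
      regroup₁ : ∀ n H P₀ → n * (32 * (4 * H * (2 * P₀))) ≡ 256 * H * (n * P₀)
      regroup₁ = solve-∀
      regroup₂ : ∀ H a → 256 * H * (2 * (2 * (2 * H * a))) ≡ 2048 * (H * H) * a
      regroup₂ = solve-∀
    main : richCount L * length ps * length qs * L ≤ 2 * (n * n * (length (units m) * μ))
    main = richCount-bound {P = P} {P₀} {L} {Q} {μ} (admissiblePrimes-unique m P₀ P) (admissiblePrimes-unique m 0 Q)
      ∈-admissiblePrimes (λ q∈ → let pq , q∤m , _ , q≤Q = ∈-admissiblePrimes {P₀ = 0} q∈ in pq , q∤m , q≤Q)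
      (≤-trans (length-filter (admissible? m P₀) (primesUpTo P)) (length-primesUpTo 1≤P)) 2P≤n 16P≤L 2Q≤nP₀ m≤2^μ

-- From the tail to the mean

-- x³ + 2s³ − 3s²x = (x − s)² (x + 2s)
tangent : ∀ s x → 3 * (s * s * x) ≤ cube x + 2 * cube s
tangent s x with ≤-total s x
... | inj₁ s≤x = subst (λ x → 3 * (s * s * x) ≤ cube x + 2 * cube s) (m+[n∸m]≡n s≤x)
  (≤-trans (m≤m+n _ _) (≤-reflexive (identity s (x ∸ s))))
  where
  identity : ∀ s d → 3 * (s * s * (s + d)) + d * d * (3 * s + d) ≡ (s + d) * (s + d) * (s + d) + 2 * (s * s * s)
  identity = solve-∀
... | inj₂ x≤s = subst (λ s → 3 * (s * s * x) ≤ cube x + 2 * cube s) (m+[n∸m]≡n x≤s)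
  (≤-trans (m≤m+n _ _) (≤-reflexive (identity x (s ∸ x))))
  where
  identity : ∀ x d → 3 * ((x + d) * (x + d) * x) + d * d * (3 * x + 2 * d) ≡ x * x * x + 2 * ((x + d) * (x + d) * (x + d))
  identity = solve-∀

-- Apply `tangent` at s to the values N f(x). Their mean is s, so after summation the linear terms
-- combine to 3 N s³; scaling by N avoids dividing.
power-mean : {A : Set} (f : A → ℕ) (xs : List A) → cube (∑ xs f) ≤ length xs * length xs * ∑ xs (λ x → cube (f x))
power-mean f [] = z≤n
power-mean f xs@(_ ∷ _) = *-cancelˡ-≤ N (+-cancelʳ-≤ (2 * (N * cube s)) _ _ (begin
  N * cube s + 2 * (N * cube s)                       ≡⟨ triple N s ⟩
  3 * (s * s * (N * s))                               ≡⟨ trans (∑-cong (λ x → assoc s N (f x)) xs) (trans (∑-*ˡ (3 * (s * s * N)) f xs) (sym (assoc s N s))) ⟨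
  ∑ xs (λ x → 3 * (s * s * (N * f x)))                ≤⟨ ∑-mono xs (λ {x} _ → tangent s (N * f x)) ⟩
  ∑ xs (λ x → cube (N * f x) + 2 * cube s)            ≡⟨ trans (∑-+ (λ x → cube (N * f x)) (λ _ → 2 * cube s) xs) (cong₂ _+_ (trans (∑-cong (λ x → cube-* N (f x)) xs) (∑-*ˡ (cube N) _ xs)) (∑-const (2 * cube s) xs)) ⟩
  cube N * F + N * (2 * cube s)                       ≡⟨ regroup N F (cube s) ⟩
  N * (N * N * F) + 2 * (N * cube s)                  ∎))
  where
  open ≤-Reasoning
  N = length xs
  s = ∑ xs f
  F = ∑ xs (λ x → cube (f x))
  triple : ∀ N s → N * (s * s * s) + 2 * (N * (s * s * s)) ≡ 3 * (s * s * (N * s))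
  triple = solve-∀
  assoc : ∀ s N x → 3 * (s * s * (N * x)) ≡ 3 * (s * s * N) * x
  assoc = solve-∀
  cube-* : ∀ N x → N * x * (N * x) * (N * x) ≡ N * N * N * (x * x * x)
  cube-* = solve-∀
  regroup : ∀ N F c → N * N * N * F + N * (2 * c) ≡ N * (N * N * F) + 2 * (N * c)
  regroup = solve-∀

dyadic-level : ∀ {M} k → 1 ≤ M → M < 2 ^ k → ∃[ j ] j < k × 2 ^ j ≤ M × M < 2 ^ suc j
dyadic-level zero 1≤M M<1 = contradiction M<1 (≤⇒≯ 1≤M)
dyadic-level {M} (suc k) 1≤M M<2^ with 2 ^ k ≤? M
... | yes 2^k≤M = k , ≤-refl , 2^k≤M , M<2^
... | no 2^k≰M with dyadic-level k 1≤M (≰⇒> 2^k≰M)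
...   | j , j<k , bounds = j , m<n⇒m<1+n j<k , bounds

-- The single level with 2^j ≤ M < 2^(j + 1) already suffices, at the price of 2³ = 8.
dyadic-cube : ∀ {M} k → M < 2 ^ k → cube M ≤ 8 * ∑ (upTo k) (λ j → 𝟙 (2 ^ j ≤? M) * cube (2 ^ j))
dyadic-cube {zero} k _ = z≤n
dyadic-cube {M@(suc _)} k M<2^k with dyadic-level k (s≤s z≤n) M<2^k
... | j , j<k , 2^j≤M , M<2^1+j = begin
  cube M                                   ≤⟨ cube-mono (<⇒≤ M<2^1+j) ⟩
  cube (2 * 2 ^ j)                         ≡⟨ cube-double (2 ^ j) ⟩
  8 * cube (2 ^ j)                         ≡⟨ cong (8 *_) (trans (cong (_* cube (2 ^ j)) (𝟙-yes (2 ^ j ≤? M) 2^j≤M)) (*-identityˡ _)) ⟨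
  8 * (𝟙 (2 ^ j ≤? M) * cube (2 ^ j))      ≤⟨ *-monoʳ-≤ 8 (∈⇒≤∑ (λ j → 𝟙 (2 ^ j ≤? M) * cube (2 ^ j)) (∈-upTo⁺ j<k)) ⟩
  8 * ∑ (upTo k) (λ j → 𝟙 (2 ^ j ≤? M) * cube (2 ^ j)) ∎
  where
  open ≤-Reasoning
  cube-double : ∀ a → 2 * a * (2 * a) * (2 * a) ≡ 8 * (a * a * a)
  cube-double = solve-∀

-- The third moment splits into k dyadic levels, each bounded by the tail hypothesis at L = 2^j;
-- `power-mean` passes from the third moment to the mean.
cube-from-tails : {A : Set} (f : A → ℕ) (xs : List A) (k B : ℕ) → (∀ x → f x < 2 ^ k) →
  (∀ L → ∑ xs (λ x → 𝟙 (L ≤? f x)) * cube L ≤ length xs * B) →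
  cube (∑ xs f) ≤ cube (length xs) * (8 * (k * B))
cube-from-tails f xs k B f<2^k tail = begin
  cube (∑ xs f)                                                        ≤⟨ power-mean f xs ⟩
  N * N * ∑ xs (λ x → cube (f x))                                      ≤⟨ *-monoʳ-≤ (N * N) (∑-mono xs (λ {x} _ → dyadic-cube k (f<2^k x))) ⟩
  N * N * ∑ xs (λ x → 8 * ∑ (upTo k) (λ j → 𝟙 (2 ^ j ≤? f x) * cube (2 ^ j)))
    ≡⟨ cong (N * N *_) (trans (∑-*ˡ 8 _ xs) (cong (8 *_) (∑-swap xs (upTo k) (λ x j → 𝟙 (2 ^ j ≤? f x) * cube (2 ^ j))))) ⟩
  N * N * (8 * ∑ (upTo k) (λ j → ∑ xs (λ x → 𝟙 (2 ^ j ≤? f x) * cube (2 ^ j))))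
    ≡⟨ cong (λ s → N * N * (8 * s)) (∑-cong (λ j → ∑-*ʳ (cube (2 ^ j)) _ xs) (upTo k)) ⟩
  N * N * (8 * ∑ (upTo k) (λ j → ∑ xs (λ x → 𝟙 (2 ^ j ≤? f x)) * cube (2 ^ j)))
    ≤⟨ *-monoʳ-≤ (N * N) (*-monoʳ-≤ 8 (∑-≤-const (upTo k) (λ {j} _ → tail (2 ^ j)))) ⟩
  N * N * (8 * (length (upTo k) * (N * B)))
    ≡⟨ cong (λ l → N * N * (8 * (l * (N * B)))) (length-upTo k) ⟩
  N * N * (8 * (k * (N * B)))
    ≡⟨ regroup N k B ⟩
  cube N * (8 * (k * B)) ∎
  where
  open ≤-Reasoning
  N = length xs
  regroup : ∀ N k B → N * N * (8 * (k * (N * B))) ≡ N * N * N * (8 * (k * B))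
  regroup = solve-∀

-- The hash family as an instance

foldr-⊔-attained : (f : ℕ → ℕ) (xs : List ℕ) → ∃[ b ] foldr _⊔_ 0 (map f xs) ≤ f b
-- The maximum over no bins is 0, so any witness does; this is why the statement is an inequality.
foldr-⊔-attained f [] = 0 , z≤n
foldr-⊔-attained f (x ∷ xs) with foldr-⊔-attained f xs
... | b , h with ≤-total (f x) (f b)
...   | inj₁ fx≤fb = b , ⊔-lub fx≤fb h
...   | inj₂ fb≤fx = x , ⊔-lub ≤-refl (≤-trans h fb≤fx)

𝟙-×-dec : {P Q : Set} (d : Dec P) (e : Dec Q) → 𝟙 (d ×-dec e) ≡ 𝟙 d * 𝟙 e
𝟙-×-dec (yes _) e = sym (+-identityʳ _)
𝟙-×-dec (no _) e = refl

elements : ∀ {m} → Subset m → List ℕ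
elements {m} X = map toℕ (filter (_∈? X) (allFin m))

elements-unique : ∀ {m} (X : Subset m) → Unique (elements X)
elements-unique {m} X = map⁺ toℕ-injective (filter⁺ (_∈? X) (allFin⁺ m))

elements<m : ∀ {m} (X : Subset m) {x} → x ∈ elements X → x < m
elements<m X x∈ with ∈-map⁻ toℕ x∈
... | i , _ , refl = toℕ<n i

size-∑ : ∀ {m} (X : Subset m) → ∑ (allFin m) (λ i → 𝟙 (i ∈? X)) ≡ ∣ X ∣
size-∑ Vec.[] = refl
size-∑ {suc m} (s Vec.∷ X) = trans (cong (λ t → 𝟙 (zero ∈? (s Vec.∷ X)) + t) tail) (head s)
  where
  tail : ∑ (tabulate suc) (λ i → 𝟙 (i ∈? (s Vec.∷ X))) ≡ ∣ X ∣
  tail = begin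
    ∑ (tabulate suc) (λ i → 𝟙 (i ∈? (s Vec.∷ X)))             ≡⟨ cong (λ is → ∑ is (λ i → 𝟙 (i ∈? (s Vec.∷ X)))) (sym (map-tabulate id suc)) ⟩
    ∑ (map suc (allFin m)) (λ i → 𝟙 (i ∈? (s Vec.∷ X)))       ≡⟨ ∑-map _ suc (allFin m) ⟩
    ∑ (allFin m) (λ i → 𝟙 (i ∈? X))                       ≡⟨ size-∑ X ⟩
    ∣ X ∣                                                 ∎
    where open ≡-Reasoning
  head : ∀ s → 𝟙 (zero ∈? (s Vec.∷ X)) + ∣ X ∣ ≡ ∣ s Vec.∷ X ∣
  head true = refl
  head false = refl

length-elements : ∀ {m} (X : Subset m) → length (elements X) ≡ ∣ X ∣
length-elements {m} X = begin
  length (elements X)                          ≡⟨ length-map toℕ (filter (_∈? X) (allFin m)) ⟩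
  length (filter (_∈? X) (allFin m))           ≡⟨ length-filter-∑ (_∈? X) (allFin m) ⟩
  ∑ (allFin m) (λ i → 𝟙 (i ∈? X))              ≡⟨ size-∑ X ⟩
  ∣ X ∣                                        ∎
  where open ≡-Reasoning

load≡∑ : ∀ {m n} .{{_ : NonZero m}} (a : ℕ) (X : Subset m) (b : ℕ) →
  load m n a X b ≡ ∑ (elements X) (λ x → 𝟙 ((n * ((a * x) % m)) / m ≟ b))
load≡∑ {m} {n} a X b = begin
  load m n a X b
    ≡⟨ length-filter-∑ (λ i → (i ∈? X) ×-dec (bin m n a (toℕ i) ≟ b)) (allFin m) ⟩
  ∑ (allFin m) (λ i → 𝟙 ((i ∈? X) ×-dec (bin m n a (toℕ i) ≟ b)))
    ≡⟨ ∑-cong (λ i → 𝟙-×-dec (i ∈? X) (bin m n a (toℕ i) ≟ b)) (allFin m) ⟩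
  ∑ (allFin m) (λ i → 𝟙 (i ∈? X) * 𝟙 (bin m n a (toℕ i) ≟ b))
    ≡⟨ ∑-filter (_∈? X) _ (allFin m) ⟨
  ∑ (filter (_∈? X) (allFin m)) (λ i → 𝟙 (bin m n a (toℕ i) ≟ b))
    ≡⟨ ∑-map _ toℕ (filter (_∈? X) (allFin m)) ⟨
  ∑ (elements X) (λ x → 𝟙 ((n * ((a * x) % m)) / m ≟ b)) ∎
  where open ≡-Reasoning

maxload-attained : ∀ {m} n .{{_ : NonZero m}} (X : Subset m) (a : ℕ) →
  ∃[ b ] maxload m n a X ≤ ∑ (elements X) (λ x → 𝟙 ((n * ((a * x) % m)) / m ≟ b))
maxload-attained {m} n X a with foldr-⊔-attained (load m n a X) (upTo n)
... | b , h = b , ≤-trans h (≤-reflexive (load≡∑ {n = n} a X b))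

n<2^1+log : ∀ n → n < 2 ^ (1 + ⌊log₂ n ⌋)
n<2^1+log n = ≰⇒> λ 2^≤n → contradiction
  (≤-trans (≤-reflexive (sym (⌊log₂[2^n]⌋≡n (1 + ⌊log₂ n ⌋)))) (⌊log₂⌋-mono-≤ 2^≤n)) 1+n≰n

polylogConstant : ℕ → ℕ
polylogConstant C = 2 * (64 * 4) * (2048 * 16) * suc C + cube (32 * (16 * suc C + 4))

-- With h = 2 l and μ = (C + 1) l the first summand has degree 7 in l. The threshold has degree at
-- most 3, so its cube accounts for the exponent 9.
tailConstant-polylog : ∀ C l → 1 ≤ l → tailConstant (2 * l) (suc C * l) ≤ polylogConstant C * l ^ 9
tailConstant-polylog C l 1≤l = begin
  2 * (64 * H) * (2048 * (H * H)) * (suc C * l) + cube (32 * threshold h (suc C * l))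
    ≡⟨ cong (_+ cube (32 * threshold h (suc C * l))) (first 64 2048 (suc C) l) ⟩
  2 * (64 * 4) * (2048 * 16) * suc C * (l * l * l * l * l * l * l) + cube (32 * threshold h (suc C * l))
    ≤⟨ +-mono-≤ (*-monoʳ-≤ (2 * (64 * 4) * (2048 * 16) * suc C) seven) (cube-mono (*-monoʳ-≤ 32 threshold≤)) ⟩
  2 * (64 * 4) * (2048 * 16) * suc C * l ^ 9 + cube (32 * ((16 * suc C + 4) * (l * l * l)))
    ≡⟨ cong (λ t → 2 * (64 * 4) * (2048 * 16) * suc C * l ^ 9 + t) (second 32 (16 * suc C + 4) l) ⟩
  2 * (64 * 4) * (2048 * 16) * suc C * l ^ 9 + cube (32 * (16 * suc C + 4)) * l ^ 9
    ≡⟨ *-distribʳ-+ (l ^ 9) (2 * (64 * 4) * (2048 * 16) * suc C) (cube (32 * (16 * suc C + 4))) ⟨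
  polylogConstant C * l ^ 9 ∎
  where
  open ≤-Reasoning
  h = 2 * l
  H = h * h
  first : ∀ a g k l → 2 * (a * (2 * l * (2 * l))) * (g * ((2 * l * (2 * l)) * (2 * l * (2 * l)))) * (k * l)
    ≡ 2 * (a * 4) * (g * 16) * k * (l * l * l * l * l * l * l)
  first = solve-∀
  ninth : ∀ l → l * l * l * l * l * l * l * (l * l) ≡ l * (l * (l * (l * (l * (l * (l * (l * (l * 1))))))))
  ninth = solve-∀
  seven : l * l * l * l * l * l * l ≤ l ^ 9
  seven = ≤-trans (m≤m*n _ (l * l) {{>-nonZero (*-mono-≤ 1≤l 1≤l)}}) (≤-reflexive (ninth l))
  second : ∀ a d l → a * (d * (l * l * l)) * (a * (d * (l * l * l))) * (a * (d * (l * l * l)))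
    ≡ a * d * (a * d) * (a * d) * (l * (l * (l * (l * (l * (l * (l * (l * (l * 1)))))))))
  second = solve-∀
  sixteen : ∀ k l → 4 * (2 * l * (2 * l)) * (k * l) + 4 * (l * l * l) ≡ (16 * k + 4) * (l * l * l)
  sixteen = solve-∀
  threshold≤ : threshold h (suc C * l) ≤ (16 * suc C + 4) * (l * l * l)
  threshold≤ = begin
    4 * H * (suc C * l) + 4                     ≤⟨ +-monoʳ-≤ (4 * H * (suc C * l)) (*-monoʳ-≤ 4 (*-mono-≤ (*-mono-≤ 1≤l 1≤l) 1≤l)) ⟩
    4 * H * (suc C * l) + 4 * (l * l * l)       ≡⟨ sixteen (suc C) l ⟩
    (16 * suc C + 4) * (l * l * l)              ∎

divℚ-cube≤ : ∀ s u R → cube s ≤ cube u * R → divℚ s u ℚ.* divℚ s u ℚ.* divℚ s u ℚ.≤ ℕtoℚ R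
-- Division by zero is 0 by convention, so this case only says that R is nonnegative.
divℚ-cube≤ s zero R _ = ℚ.toℚᵘ-cancel-≤ (ℚᵘ.≤-respʳ-≃ (ℚᵘ.≃-sym (ℚ.toℚᵘ-fromℚᵘ (mkℚᵘ (+ R) 0)))
  (*≤* (subst (0ℤ ℤ.≤_) (sym (ℤ.*-identityʳ (+ R))) (ℤ.+≤+ z≤n))))
divℚ-cube≤ s (suc u) R h = ℚ.toℚᵘ-cancel-≤
  (ℚᵘ.≤-respˡ-≃ (ℚᵘ.≃-sym cube≃) (ℚᵘ.≤-respʳ-≃ (ℚᵘ.≃-sym (ℚ.toℚᵘ-fromℚᵘ (mkℚᵘ (+ R) 0))) (*≤* bound)))
  where
  q = divℚ s (suc u)
  qᵘ = mkℚᵘ (+ s) u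
  q≃ : ℚ.toℚᵘ q ℚᵘ.≃ qᵘ
  q≃ = ℚ.toℚᵘ-fromℚᵘ qᵘ
  cube≃ : ℚ.toℚᵘ (q ℚ.* q ℚ.* q) ℚᵘ.≃ qᵘ ℚᵘ.* qᵘ ℚᵘ.* qᵘ
  cube≃ = ℚᵘ.≃-trans (ℚ.toℚᵘ-homo-* (q ℚ.* q) q)
    (ℚᵘ.*-cong (ℚᵘ.≃-trans (ℚ.toℚᵘ-homo-* q q) (ℚᵘ.*-cong q≃ q≃)) q≃)
  bound : + s ℤ.* + s ℤ.* + s ℤ.* + 1 ℤ.≤ + R ℤ.* + (suc u * suc u * suc u)
  bound = subst₂ ℤ._≤_
    (trans (trans (ℤ.pos-* (s * s) s) (cong (ℤ._* + s) (ℤ.pos-* s s))) (sym (ℤ.*-identityʳ _)))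
    (trans (cong +_ (*-comm (cube (suc u)) R)) (ℤ.pos-* R (cube (suc u))))
    (ℤ.+≤+ h)

-- The bound is cubed so that n^(1/3) need not be formed among the rationals; the 1 added to the
-- integer logarithm keeps the base of the power positive.
mainTheorem2 : (C : ℕ) → ∃[ c ] ∃[ K ] ∃[ N₀ ] ((n : ℕ) → N₀ ≤ n → (m : ℕ) → .{{_ : NonZero m}}
    → n ^ 5 < m ^ 2 → m ≤ n ^ C → (X : Subset m) → ∣ X ∣ ≡ n
    → expectedMaxload m n X ℚ.* expectedMaxload m n X ℚ.* expectedMaxload m n X
    ℚ.≤ ℕtoℚ (c * n * (1 + ⌊log₂ n ⌋) ^ K))
-- The 8 comes from `dyadic-cube`. The exponent is 9 from `tailConstant-polylog` plus 1 for the
-- number of dyadic levels, and `N₀ = 1` supplies n > 0.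
mainTheorem2 C = 8 * polylogConstant C , 10 , 1 , λ n 1≤n m _ m≤n^C X ∣X∣≡n →
  divℚ-cube≤ (∑ (units m) (λ a → maxload m n a X)) (length (units m)) _ (bound n 1≤n m m≤n^C X ∣X∣≡n)
  where
  open ≤-Reasoning
  bound : ∀ n → 1 ≤ n → ∀ m → .{{_ : NonZero m}} → m ≤ n ^ C → (X : Subset m) → ∣ X ∣ ≡ n →
    cube (∑ (units m) (λ a → maxload m n a X)) ≤ cube (length (units m)) * (8 * polylogConstant C * n * (1 + ⌊log₂ n ⌋) ^ 10)
  bound n 1≤n m m≤n^C X ∣X∣≡n = begin
    cube (∑ (units m) (λ a → maxload m n a X))
      ≤⟨ cube-from-tails (λ a → maxload m n a X) (units m) l (n * tailConstant (2 * l) (suc C * l))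
           (λ a → ≤-<-trans (peakLoad≤n a) (n<2^1+log n))
           (richCount-tail (elements X) (elements-unique X) (elements<m X) length≡n (λ a → maxload m n a X) (maxload-attained n X)
             {l} {suc C * l} (s≤s z≤n) (s≤s z≤n) (n<2^1+log n) m≤2^) ⟩
    cube (length (units m)) * (8 * (l * (n * tailConstant (2 * l) (suc C * l))))
      ≤⟨ *-monoʳ-≤ (cube (length (units m))) (*-monoʳ-≤ 8 (*-monoʳ-≤ l (*-monoʳ-≤ n (tailConstant-polylog C l (s≤s z≤n))))) ⟩
    cube (length (units m)) * (8 * (l * (n * (polylogConstant C * l ^ 9))))
      ≡⟨ cong (cube (length (units m)) *_) (regroup l n (polylogConstant C) (l ^ 9)) ⟩
    cube (length (units m)) * (8 * polylogConstant C * n * l ^ 10) ∎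
    where
    l = 1 + ⌊log₂ n ⌋
    instance
      n≢0 : NonZero n
      n≢0 = >-nonZero 1≤n
    length≡n : length (elements X) ≡ n
    length≡n = trans (length-elements X) ∣X∣≡n
    open Loads {n = n} (elements X) (elements-unique X) (elements<m X) length≡n (λ a → maxload m n a X) (maxload-attained n X) using (peakLoad≤n)
    -- Taking `suc C` in place of `C` keeps μ positive even for C = 0, as `richCount-tail` requires.
    m≤2^ : m ≤ 2 ^ (suc C * l)
    m≤2^ = begin
      m                    ≤⟨ m≤n^C ⟩
      n ^ C                ≤⟨ ^-monoˡ-≤ C (<⇒≤ (n<2^1+log n)) ⟩
      (2 ^ l) ^ C          ≡⟨ ^-*-assoc 2 l C ⟩
      2 ^ (l * C)          ≡⟨ cong (2 ^_) (*-comm l C) ⟩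
      2 ^ (C * l)          ≤⟨ ^-monoʳ-≤ 2 (m≤n+m (C * l) l) ⟩
      2 ^ (suc C * l)      ∎
    regroup : ∀ l n c x → 8 * (l * (n * (c * x))) ≡ 8 * c * n * (l * x)
    regroup = solve-∀
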